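{- Let $P$ be a $d$-dimensional permutation matrix and let $k_1,\ldots,k_d$ be positive integers at least two of which are greater than $1$. Let $$\alpha(k_1,\ldots,k_d)=\frac{\max(k_1,\ldots,k_d)}{k_1\cdot k_2\cdots k_d},\qquad \beta(k_1,\ldots,k_d)=\frac{k_1+\cdots+k_d-d}{k_1\cdot k_2\cdots k_d-1}.$$ Then there exist positive constants $C_1$ and $C_2$ such that for all positive integers $n$, $$C_1 n^{d-\beta(k_1,\ldots,k_d)}\le f(n,P\otimes R^{k_1,\ldots,k_d},d)\le C_2 n^{d-\alpha(k_1,\ldots,k_d)}.$$
   Context: A $d$-dimensional $n_1\times\cdots\times n_d$ zero-one matrix is an array $A=(a_{i_1,\ldots,i_d})$, $1\le i_\ell\le n_\ell$, with entries in $\{0,1\}$. A submatrix is obtained by selecting, for each $\ell$, a set of values of the $\ell$-th coordinate (keeping the order). $A$ contains a $d$-dimensional zero-one matrix $B$ if some submatrix of $A$ can be transformed into $B$ by changing any number of ones to zeros; otherwise $A$ avoids $B$. $f(n,B,d)$ denotes the maximum number of ones in a $d$-dimensional $n\times\cdots\times n$ zero-one matrix that avoids $B$. An $\ell$-cross section is the set of all entries having a fixed value of the $\ell$-th coordinate. A $d$-dimensional $k\times\cdots\times k$ zero-one matrix is a permutation matrix if each of its $\ell$-cross sections contains exactly one nonzero entry, for every $\ell=1,\ldots,d$. $R^{k_1,\ldots,k_d}$ is the $k_1\times\cdots\times k_d$ matrix of all ones. The Kronecker product $M\otimes N$ of two $d$-dimensional zero-one matrices is obtained by replacing each $1$-entry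 of $M$ by a copy of $N$ and each $0$-entry of $M$ by a zero matrix of the same size as $N$. -}

module Defs where

open import Data.Bool using (Bool; true; false; if_then_else_)
import Data.Bool as Bool
import Data.Bool.Properties as Boolₚ
open import Data.Fin using (Fin; zero; suc; remQuot)
import Data.Fin as Fin
import Data.Fin.Properties as Finₚ
open import Data.Integer using (ℤ; +_; -[1+_])
import Data.Integer as ℤ
open import Data.List using (List; []; _∷_; [_]; map; length; filter; filterᵇ;
  allFin; cartesianProductWith)
open import Data.List.Extrema.Nat using (max; xs≤max; argmax-sel)
open import Data.List.Membership.Propositional using (_∈_)
open import Data.List.Membership.Propositional.Properties
  using (∈-map⁺; ∈-map⁻; ∈-filter⁺; ∈-filter⁻; ∈-cartesianProductWith⁺)
import Data.List.Relation.Unary.All as Listᴬ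
open import Data.List.Relation.Unary.Any using (here; there)
open import Data.Nat using (ℕ; zero; suc; _*_; _∸_; _^_; _≤_; _<_; _⊔_; NonZero;
  >-nonZero)
import Data.Nat.Properties as ℕₚ
open import Data.Product using (_×_; _,_; ∃; ∃₂; ∃!; proj₁; proj₂)
open import Data.Rational using (ℚ; 1ℚ; _/_; ↥_; ↧ₙ_)
import Data.Rational as ℚ
open import Data.Sum using (inj₁; inj₂)
open import Data.Vec using (Vec; []; _∷_; lookup; replicate; zipWith; foldr′; sum)
import Data.Vec.Functional as Vector
open import Data.Vec.Relation.Binary.Pointwise.Inductive using (Pointwise; []; _∷_)
open import Data.Vec.Relation.Unary.All using (All; []; _∷_)
open import Data.Vec.Relation.Unary.All.Properties using (lookup⁺)
open import Data.Vec.Relation.Unary.AllPairs using (AllPairs; allPairs?; irrelevant)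
open import Function using (id; _∘_)
open import Relation.Binary.PropositionalEquality
  using (_≡_; _≢_; _≗_; refl; sym; trans; cong; subst)
open import Relation.Nullary using (Dec; yes; no; ¬_; ¬?)
open import Relation.Nullary.Decidable using (map′; _×-dec_)
open import Relation.Unary using (Decidable)

private
  variable
    d : ℕ
    ks ns : Vec ℕ d

-- An element of Index (n₁ ∷ … ∷ n_d ∷ []) is a tuple (i₁, …, i_d) with
-- i_ℓ : Fin n_ℓ; coordinates are numbered from 0.  Its coordinate i_ℓ is
-- lookup⁺ i ℓ.

Index : Vec ℕ d → Set
Index = All Fin

Matrix : Vec ℕ d → Set
Matrix ns = Index ns → Bool

cube : (d n : ℕ) → Vec ℕ d
cube = replicate

allIndices : (ns : Vec ℕ d) → List (Index ns)
allIndices []       = [ [] ]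
allIndices (n ∷ ns) = cartesianProductWith _∷_ (allFin n) (allIndices ns)

ones : Matrix ns → ℕ
ones {ns = ns} A = length (filterᵇ A (allIndices ns))

-- k ↪ n is the type of k-element sets of values of a coordinate ranging over
-- Fin n, each set being listed in increasing order.

infix 4 _↪_

_↪_ : ℕ → ℕ → Set
k ↪ n = ∃ λ (v : Vec (Fin n) k) → AllPairs Fin._<_ v

Selection : Vec ℕ d → Vec ℕ d → Set
Selection = Pointwise _↪_

select : {ks ns : Vec ℕ d} → Selection ks ns → Index ks → Index ns
select []            []       = []
select ((v , _) ∷ σ) (i ∷ is) = lookup v i ∷ select σ is

submatrix : {ks ns : Vec ℕ d} → Matrix ns → Selection ks ns → Matrix ks
submatrix A σ = A ∘ select σ

-- With false ≤ true, the entrywise order says that B arises from the submatrix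
-- by changing some ones to zeros.

Contains : {ks ns : Vec ℕ d} → Matrix ns → Matrix ks → Set
Contains {ks = ks} {ns = ns} A B =
  ∃ λ (σ : Selection ks ns) → ∀ i → B i Bool.≤ submatrix A σ i

Avoids : {ks ns : Vec ℕ d} → Matrix ns → Matrix ks → Set
Avoids A B = ¬ Contains A B

IsPermutation : Matrix ns → Set
IsPermutation {d} {ns} P =
  (ℓ : Fin d) (j : Fin (lookup ns ℓ)) →
  ∃! _≡_ λ (i : Index ns) → lookup⁺ i ℓ ≡ j × P i ≡ true

R : (ks : Vec ℕ d) → Matrix ks
R ks _ = true

-- An index of M ⊗ N is a pair: which copy of N, and which entry of that copy.
-- In each coordinate, i = n * p + q corresponds to (p , q) with q < n.

blockIndex : (ms ns : Vec ℕ d) → Index (zipWith _*_ ms ns) → Index ms × Index ns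
blockIndex []       []       []       = [] , []
blockIndex (m ∷ ms) (n ∷ ns) (i ∷ is) =
  let p , q   = remQuot {m} n i
      ps , qs = blockIndex ms ns is
  in  p ∷ ps , q ∷ qs

infixl 7 _⊗_

_⊗_ : {ms ns : Vec ℕ d} → Matrix ms → Matrix ns → Matrix (zipWith _*_ ms ns)
_⊗_ {ms = ms} {ns = ns} M N i =
  let p , q = blockIndex ms ns i in if M p then N q else false

private

  anyVec? : ∀ {n} k {P : Vec (Fin n) k → Set} → Decidable P → Dec (∃ P)
  anyVec? zero    P? = map′ ([] ,_) (λ { ([] , p) → p }) (P? [])
  anyVec? (suc k) P? =
    map′ (λ { (x , v , p) → x ∷ v , p }) (λ { (x ∷ v , p) → x , v , p })
         (Finₚ.any? λ x → anyVec? k λ v → P? (x ∷ v))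

  any↪? : ∀ k n {P : k ↪ n → Set} → Decidable P → Dec (∃ P)
  any↪? k n {P} P? =
    map′ (λ { (v , o , p) → (v , o) , p }) (λ { ((v , o) , p) → v , o , p })
         (anyVec? k λ v → any-inc v)
    where
    inc-irr : ∀ {k} {v : Vec (Fin n) k} (o o′ : AllPairs Fin._<_ v) → o ≡ o′
    inc-irr = irrelevant Finₚ.<-irrelevant
    any-inc : ∀ v → Dec (∃ λ o → P (v , o))
    any-inc v with allPairs? Finₚ._<?_ v
    ... | no ¬o = no (¬o ∘ proj₁)
    ... | yes o = map′ (o ,_)
      (λ { (o′ , p) → subst (λ o → P (v , o)) (inc-irr o′ o) p }) (P? (v , o))

  anySelection? : (ks ns : Vec ℕ d) {P : Selection ks ns → Set} →
                  Decidable P → Dec (∃ P)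
  anySelection? []       []       P? = map′ ([] ,_) (λ { ([] , p) → p }) (P? [])
  anySelection? (k ∷ ks) (n ∷ ns) P? =
    map′ (λ { (e , σ , p) → e ∷ σ , p }) (λ { (e ∷ σ , p) → e , σ , p })
         (any↪? k n λ e → anySelection? ks ns λ σ → P? (e ∷ σ))

  allIndex? : (ks : Vec ℕ d) {P : Index ks → Set} →
              Decidable P → Dec (∀ i → P i)
  allIndex? []       P? = map′ (λ { p [] → p }) (λ f → f []) (P? [])
  allIndex? (k ∷ ks) P? =
    map′ (λ { f (i ∷ is) → f i is }) (λ f i is → f (i ∷ is))
         (Finₚ.all? λ i → allIndex? ks λ is → P? (i ∷ is))

contains? : {ks ns : Vec ℕ d} (A : Matrix ns) (B : Matrix ks) → Dec (Contains A B)
contains? {ks = ks} {ns = ns} A B =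
  anySelection? ks ns λ σ → allIndex? ks λ i → B i Boolₚ.≤? submatrix A σ i

avoids? : {ks ns : Vec ℕ d} (B : Matrix ks) →
          Decidable λ (A : Matrix ns) → Avoids A B
avoids? B A = ¬? (contains? A B)

allFunctions : {X : Set} (n : ℕ) → List X → List (Fin n → X)
allFunctions zero    xs = [ (λ ()) ]
allFunctions (suc n) xs =
  cartesianProductWith Vector._∷_ xs (allFunctions n xs)

-- Every matrix occurs in allMatrices up to pointwise equality.

allMatrices : (ns : Vec ℕ d) → List (Matrix ns)
allMatrices []       = (λ _ → false) ∷ (λ _ → true) ∷ []
allMatrices (n ∷ ns) =
  map (λ { g (i ∷ is) → g i is }) (allFunctions n (allMatrices ns))

-- The value is 0 when no n × ⋯ × n matrix avoids B.  That cannot happen if B has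
-- a 1-entry, since the zero matrix then avoids B.

f : ℕ → {ks : Vec ℕ d} → Matrix ks → ℕ
f {d} n B = max 0 (map ones (filter (avoids? B) (allMatrices (cube d n))))

private

  allFunctions-complete : ∀ {X : Set} {Y : Set} (_≈_ : X → Y → Set) n {xs} →
    (g : Fin n → Y) → (∀ i → ∃ λ x → x ∈ xs × x ≈ g i) →
    ∃ λ h → h ∈ allFunctions n xs × (∀ i → h i ≈ g i)
  allFunctions-complete _≈_ zero    g c = (λ ()) , here refl , (λ ())
  allFunctions-complete _≈_ (suc n) g c =
    let x , x∈ , x≈ = c zero
        h , h∈ , h≈ = allFunctions-complete _≈_ n (g ∘ suc) (c ∘ suc)
    in  x Vector.∷ h , ∈-cartesianProductWith⁺ Vector._∷_ x∈ h∈
      , λ { zero → x≈ ; (suc i) → h≈ i }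

  allMatrices-complete : (ns : Vec ℕ d) (A : Matrix ns) →
    ∃ λ A′ → A′ ∈ allMatrices ns × A′ ≗ A
  allMatrices-complete [] A with A [] in eq
  ... | false = _ , here refl         , λ { [] → sym eq }
  ... | true  = _ , there (here refl) , λ { [] → sym eq }
  allMatrices-complete (n ∷ ns) A =
    let g , g∈ , g≗ = allFunctions-complete _≗_ n (λ i is → A (i ∷ is))
                        (λ i → allMatrices-complete ns (λ is → A (i ∷ is)))
    in  _ , ∈-map⁺ _ g∈ , λ { (i ∷ is) → g≗ i is }

  length-filterᵇ-cong : {X : Set} {p q : X → Bool} → p ≗ q → ∀ xs →
    length (filterᵇ p xs) ≡ length (filterᵇ q xs)
  length-filterᵇ-cong p≗q []       = refl
  length-filterᵇ-cong {p = p} {q} p≗q (x ∷ xs) with p x | q x | p≗q x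
  ... | true  | .true  | refl = cong suc (length-filterᵇ-cong p≗q xs)
  ... | false | .false | refl = length-filterᵇ-cong p≗q xs

ones-cong : {A A′ : Matrix ns} → A ≗ A′ → ones A ≡ ones A′
ones-cong {ns = ns} A≗A′ = length-filterᵇ-cong A≗A′ (allIndices ns)

Contains-resp : {ks ns : Vec ℕ d} {A A′ : Matrix ns} {B : Matrix ks} →
                A ≗ A′ → Contains A B → Contains A′ B
Contains-resp {B = B} A≗A′ (σ , h) =
  σ , λ i → subst (B i Bool.≤_) (A≗A′ (select σ i)) (h i)

f-upper : ∀ n (B : Matrix ks) (A : Matrix (cube _ n)) →
          Avoids A B → ones A ≤ f n B
f-upper n B A av =
  let A′ , A′∈ , A′≗A = allMatrices-complete (cube _ n) A
      av′ = av ∘ Contains-resp {B = B} A′≗A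
      A′∈′ = ∈-map⁺ ones (∈-filter⁺ (avoids? B) A′∈ av′)
  in  subst (_≤ f n B) (ones-cong A′≗A)
        (Listᴬ.lookup (xs≤max 0 _) A′∈′)

f-attained : ∀ n (B : Matrix ks) → ∃ (λ (A : Matrix (cube _ n)) → Avoids A B) →
             ∃ λ (A : Matrix (cube _ n)) → Avoids A B × ones A ≡ f n B
f-attained n B (A , av)
  with argmax-sel id 0 (map ones (filter (avoids? B) (allMatrices (cube _ n))))
... | inj₁ f≡0 = A , av ,
  trans (ℕₚ.n≤0⇒n≡0 (subst (ones A ≤_) f≡0 (f-upper n B A av))) (sym f≡0)
... | inj₂ f∈ =
  let A′ , A′∈ , f≡ = ∈-map⁻ ones f∈
  in  A′ , proj₂ (∈-filter⁻ (avoids? B) {xs = allMatrices (cube _ n)} A′∈) , sym f≡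

product maximum : Vec ℕ d → ℕ
product = foldr′ _*_ 1
maximum = foldr′ _⊔_ 0

AtLeastTwo>1 : Vec ℕ d → Set
AtLeastTwo>1 ks = ∃₂ λ ℓ m → ℓ ≢ m × 1 < lookup ks ℓ × 1 < lookup ks m

product≢0 : All NonZero ks → NonZero (product ks)
product≢0 []              = _
product≢0 {ks = k ∷ ks} (k≢0 ∷ pos) =
  ℕₚ.m*n≢0 k (product ks) {{k≢0}} {{product≢0 pos}}

private

  lookup≤product : All NonZero ks → ∀ ℓ → lookup ks ℓ ≤ product ks
  lookup≤product {ks = k ∷ ks} (_ ∷ pos) zero =
    ℕₚ.m≤m*n k (product ks) {{product≢0 pos}}
  lookup≤product {ks = k ∷ ks} (k≢0 ∷ pos) (suc ℓ) =
    ℕₚ.≤-trans (lookup≤product pos ℓ) (ℕₚ.m≤n*m (product ks) k {{k≢0}})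

product∸1≢0 : All NonZero ks → AtLeastTwo>1 ks → NonZero (product ks ∸ 1)
product∸1≢0 pos (ℓ , _ , _ , 1<kℓ , _) =
  >-nonZero (ℕₚ.m<n⇒0<n∸m (ℕₚ.<-≤-trans 1<kℓ (lookup≤product pos ℓ)))

α : (ks : Vec ℕ d) → All NonZero ks → ℚ
α ks pos = + maximum ks / product ks
  where instance _ = product≢0 pos

β : (ks : Vec ℕ d) → All NonZero ks → AtLeastTwo>1 ks → ℚ
β {d} ks pos two = (+ sum ks ℤ.- + d) / (product ks ∸ 1)
  where instance _ = product∸1≢0 pos two

toℚ : ℕ → ℚ
toℚ n = + n / 1

infixr 8 _^ℕ_ _^ℤ_

_^ℕ_ : ℚ → ℕ → ℚ
q ^ℕ zero  = 1ℚ
q ^ℕ suc n = q ℚ.* q ^ℕ n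

_^ℤ_ : (n : ℕ) .{{_ : NonZero n}} → ℤ → ℚ
n ^ℤ (+ a)    = toℚ (n ^ a)
n ^ℤ -[1+ a ] = + 1 / (n ^ suc a)
  where instance _ = ℕₚ.m^n≢0 n (suc a)

-- For r = a / b in lowest terms with b > 0, the real number n ^ r is the
-- non-negative b-th root of n ^ a.  As x ↦ x ^ b is strictly increasing on the
-- non-negative reals, for C ≥ 0 the inequalities
--   C · n ^ r ≤ m   and   m ≤ C · n ^ r
-- between real numbers mean that their b-th powers are so ordered.  The
-- relations below are only used with C > 0.

infix 4 _·_^_≤ʳ_ _≤ʳ_·_^_

_·_^_≤ʳ_ : ℚ → (n : ℕ) → ℚ → ℕ → .{{_ : NonZero n}} → Set
C · n ^ r ≤ʳ m = C ^ℕ (↧ₙ r) ℚ.* n ^ℤ (↥ r) ℚ.≤ toℚ m ^ℕ (↧ₙ r)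

_≤ʳ_·_^_ : ℕ → ℚ → (n : ℕ) → ℚ → .{{_ : NonZero n}} → Set
m ≤ʳ C · n ^ r = toℚ m ^ℕ (↧ₙ r) ℚ.≤ C ^ℕ (↧ₙ r) ℚ.* n ^ℤ (↥ r)

{-# OPTIONS --safe #-}

-- Upper bound.  Cut a matrix of side m n into blocks of side n.  Blocks containing
-- R ks cannot form P, so there are few of them, and each again avoids P ⊗ R ks; the
-- other blocks avoid R ks and are sparse by a Kővári–Sós–Turán count of boxes.
-- For a suitable constant m = w ^ E, where E is the product of all kᵢ but the
-- largest, the recursion gives f(m ^ j) w ^ j = O(m ^ (j d)), that is,
-- f(n) = O(n ^ (d - 1 / E)).  P-avoiding matrices of side m only need density at
-- most 1 / (2 w) with w ≤ √m, so a weak form of the Marcus–Tardos argument is enough.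
-- Lower bound.  Deletion method: select each entry with probability about
-- n ^ (-β) and delete an entry from every copy of R ks.
module Submission where

open import Defs
open import Data.Bool using (Bool; true; false; T; _∧_; not; if_then_else_)
import Data.Bool as Bool
open import Data.Bool.ListAction using (all; any)
open import Data.Bool.Properties using (T-∧; T-≡; ∧-assoc; ∧-comm)
import Data.Bool.Properties as Boolₚ
open import Data.Empty using (⊥-elim)
open import Data.Fin using (Fin; zero; suc; toℕ; fromℕ<; combine; remQuot)
import Data.Fin as Fin
import Data.Fin.Properties as Finₚ
open import Data.Integer using (-[1+_])
import Data.Integer as ℤ
import Data.Integer.Properties as ℤₚ
open import Data.List using (List; []; _∷_; [_]; map; length; _++_; upTo; applyUpTo; allFin;
  cartesianProductWith; filterᵇ)
import Data.List
import Data.List.Properties as Listₚ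
open import Data.List.Membership.Propositional using (_∈_; find; lose)
open import Data.List.Membership.Propositional.Properties
open import Data.List.Relation.Unary.All as ListAll using ([]; _∷_)
import Data.List.Relation.Unary.All.Properties as ListAllₚ
open import Data.List.Relation.Unary.AllPairs as ListAllPairs using ([]; _∷_)
import Data.List.Relation.Unary.AllPairs.Properties as ListAllPairsₚ
open import Data.List.Relation.Unary.Any using (here; there)
import Data.List.Relation.Unary.Any.Properties as Anyₚ
open import Data.List.Relation.Unary.Unique.Propositional using (Unique)
import Data.List.Relation.Unary.Unique.Propositional.Properties as Uniqueₚ
open import Data.Nat using (ℕ; zero; suc; _+_; _*_; _∸_; _^_; _≤_; _<_; z≤n; s≤s; NonZero)
import Data.Nat as ℕ
open import Data.Nat.ListAction using () renaming (sum to sumᴸ; product to productᴸ)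
open import Data.Nat.ListAction.Properties using () renaming (sum-++ to sumᴸ-++)
open import Data.Nat.Properties
open import Data.Nat.Tactic.RingSolver using (solve-∀)
open import Data.Product using (_×_; _,_; ∃; ∃₂; proj₁; proj₂)
open import Data.Rational using (ℚ; 0ℚ; 1ℚ; ↥_; ↧ₙ_)
import Data.Rational as ℚ
import Data.Rational.Properties as ℚₚ
import Data.Rational.Unnormalised as ℚᵘ
import Data.Rational.Unnormalised.Properties as ℚᵘₚ
open import Data.Sum using (_⊎_; inj₁; inj₂)
open import Data.Unit using (tt)
open import Data.Vec using (Vec; []; _∷_; lookup; zipWith; sum; tabulate; _[_]≔_; toList)
import Data.Vec as Vec
import Data.Vec.Properties as Vecₚ
open import Data.Vec.Relation.Binary.Pointwise.Inductive using ([]; _∷_)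
open import Data.Vec.Relation.Unary.All using (All; []; _∷_)
open import Data.Vec.Relation.Unary.All.Properties using (lookup⁺)
import Data.Vec.Relation.Unary.All.Properties as VecAllₚ
open import Data.Vec.Relation.Unary.AllPairs using (AllPairs; []; _∷_)
open import Function using (_∘_; id; case_of_)
open import Function.Bundles using (Equivalence)
open import Relation.Binary.Definitions using (DecidableEquality; tri<; tri≈; tri>)
open import Relation.Binary.PropositionalEquality hiding ([_])
open import Relation.Nullary using (¬_; yes; no; contradiction)
open import Relation.Nullary.Decidable using (⌊_⌋; toWitness; fromWitness)

-- The exponents are fractional while all counting happens in the natural numbers. Densities are
-- therefore tested at sides whose relevant root is an integer, convexity is replaced by tangent
-- lines, and roots are removed by raising both sides to a power. Rounding a general side, or a
-- general selection probability, costs only a constant factor. The largest side is left out of E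
-- because α = 1 / E: a matrix without a full box has few full boxes of the shape in which that side
-- is shrunk to 1, so supersaturation is applied to the shrunken shape. Two sides exceeding 1 give E
-- ≥ 2, which makes room for the loss in the pattern bound. The exponent β comes from selecting
-- entries with probability 1 / q: the number n ^ sum ks / q ^ product ks of expected copies
-- balances the number n ^ d / q of expected ones at q = n ^ β.

private
  variable
    X Y : Set

-- Finite sums over lists

⟦_⟧ : Bool → ℕ
⟦ true ⟧  = 1
⟦ false ⟧ = 0

∑ : List X → (X → ℕ) → ℕ
∑ xs g = sumᴸ (map g xs)

∑-mono∈ : (xs : List X) {g h : X → ℕ} → (∀ {x} → x ∈ xs → g x ≤ h x) → ∑ xs g ≤ ∑ xs h
∑-mono∈ []       le = z≤n
∑-mono∈ (x ∷ xs) le = +-mono-≤ (le (here refl)) (∑-mono∈ xs (le ∘ there))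

∑-mono : (xs : List X) {g h : X → ℕ} → (∀ x → g x ≤ h x) → ∑ xs g ≤ ∑ xs h
∑-mono xs le = ∑-mono∈ xs (λ {x} _ → le x)

∑-cong : (xs : List X) {g h : X → ℕ} → (∀ x → g x ≡ h x) → ∑ xs g ≡ ∑ xs h
∑-cong xs eq = cong sumᴸ (Listₚ.map-cong eq xs)

∑-const : (xs : List X) (c : ℕ) → ∑ xs (λ _ → c) ≡ length xs * c
∑-const []       c = refl
∑-const (x ∷ xs) c = cong (c +_) (∑-const xs c)

∑-bound : (xs : List X) {g : X → ℕ} {c : ℕ} → (∀ {x} → x ∈ xs → g x ≤ c) → ∑ xs g ≤ length xs * c
∑-bound xs {c = c} le = ≤-trans (∑-mono∈ xs le) (≤-reflexive (∑-const xs c))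

∑-+ : (xs : List X) (g h : X → ℕ) → ∑ xs (λ x → g x + h x) ≡ ∑ xs g + ∑ xs h
∑-+ []       g h = refl
∑-+ (x ∷ xs) g h = begin
  g x + h x + ∑ xs (λ y → g y + h y) ≡⟨ cong (g x + h x +_) (∑-+ xs g h) ⟩
  g x + h x + (∑ xs g + ∑ xs h)      ≡⟨ interchange (g x) (h x) (∑ xs g) (∑ xs h) ⟩
  g x + ∑ xs g + (h x + ∑ xs h)      ∎
  where
  open ≡-Reasoning
  interchange : ∀ a b c d → a + b + (c + d) ≡ a + c + (b + d)
  interchange = solve-∀

∑-*ˡ : (xs : List X) (c : ℕ) (g : X → ℕ) → ∑ xs (λ x → c * g x) ≡ c * ∑ xs g
∑-*ˡ []       c g = sym (*-zeroʳ c)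
∑-*ˡ (x ∷ xs) c g =
  trans (cong (c * g x +_) (∑-*ˡ xs c g)) (sym (*-distribˡ-+ c (g x) (∑ xs g)))

∑-*ʳ : (xs : List X) (c : ℕ) (g : X → ℕ) → ∑ xs (λ x → g x * c) ≡ ∑ xs g * c
∑-*ʳ xs c g = begin
  ∑ xs (λ x → g x * c) ≡⟨ ∑-cong xs (λ x → *-comm (g x) c) ⟩
  ∑ xs (λ x → c * g x) ≡⟨ ∑-*ˡ xs c g ⟩
  c * ∑ xs g           ≡⟨ *-comm c _ ⟩
  ∑ xs g * c           ∎
  where open ≡-Reasoning

∑-++ : (xs ys : List X) (g : X → ℕ) → ∑ (xs ++ ys) g ≡ ∑ xs g + ∑ ys g
∑-++ xs ys g = trans (cong sumᴸ (Listₚ.map-++ g xs ys)) (sumᴸ-++ (map g xs) (map g ys))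

∑-map : (h : X → Y) (xs : List X) (g : Y → ℕ) → ∑ (map h xs) g ≡ ∑ xs (g ∘ h)
∑-map h xs g = cong sumᴸ (sym (Listₚ.map-∘ xs))

∑-cartesian : {Z : Set} (h : X → Y → Z) (xs : List X) (ys : List Y) (g : Z → ℕ) →
  ∑ (cartesianProductWith h xs ys) g ≡ ∑ xs (λ x → ∑ ys (λ y → g (h x y)))
∑-cartesian h []       ys g = refl
∑-cartesian h (x ∷ xs) ys g =
  trans (∑-++ (map (h x) ys) _ g) (cong₂ _+_ (∑-map (h x) ys g) (∑-cartesian h xs ys g))

∑-swap : (xs : List X) (ys : List Y) (g : X → Y → ℕ) →
  ∑ xs (λ x → ∑ ys (g x)) ≡ ∑ ys (λ y → ∑ xs (λ x → g x y))
∑-swap []       ys g = sym (trans (∑-const ys 0) (*-zeroʳ (length ys)))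
∑-swap (x ∷ xs) ys g =
  trans (cong (∑ ys (g x) +_) (∑-swap xs ys g)) (sym (∑-+ ys (g x) _))

∑-zero∈ : (xs : List X) {g : X → ℕ} → (∀ {x} → x ∈ xs → g x ≡ 0) → ∑ xs g ≡ 0
∑-zero∈ xs eq = n≤0⇒n≡0 (≤-trans (∑-bound xs (≤-reflexive ∘ eq)) (≤-reflexive (*-zeroʳ (length xs))))

length-cartesian : {Z : Set} (h : X → Y → Z) (xs : List X) (ys : List Y) →
  length (cartesianProductWith h xs ys) ≡ length xs * length ys
length-cartesian h []       ys = refl
length-cartesian h (x ∷ xs) ys =
  trans (Listₚ.length-++ (map (h x) ys))
        (cong₂ _+_ (Listₚ.length-map (h x) ys) (length-cartesian h xs ys))

∑-upTo-suc : ∀ n (g : ℕ → ℕ) → ∑ (upTo (suc n)) g ≡ g 0 + ∑ (upTo n) (g ∘ suc)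
∑-upTo-suc n g = cong (λ xs → g 0 + sumᴸ xs)
  (trans (Listₚ.map-applyUpTo suc g n) (sym (Listₚ.map-upTo (g ∘ suc) n)))

∑-upTo-+ : ∀ m n (g : ℕ → ℕ) → ∑ (upTo (m + n)) g ≡ ∑ (upTo m) g + ∑ (upTo n) (g ∘ (m +_))
∑-upTo-+ zero    n g = refl
∑-upTo-+ (suc m) n g = begin
  ∑ (upTo (suc m + n)) g
    ≡⟨ ∑-upTo-suc (m + n) g ⟩
  g 0 + ∑ (upTo (m + n)) (g ∘ suc)
    ≡⟨ cong (g 0 +_) (∑-upTo-+ m n (g ∘ suc)) ⟩
  g 0 + (∑ (upTo m) (g ∘ suc) + ∑ (upTo n) (g ∘ (suc m +_)))
    ≡⟨ +-assoc (g 0) _ _ ⟨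
  g 0 + ∑ (upTo m) (g ∘ suc) + ∑ (upTo n) (g ∘ (suc m +_))
    ≡⟨ cong (_+ ∑ (upTo n) (g ∘ (suc m +_))) (∑-upTo-suc m g) ⟨
  ∑ (upTo (suc m)) g + ∑ (upTo n) (g ∘ (suc m +_)) ∎
  where open ≡-Reasoning

∑-upTo-* : ∀ m n (g : ℕ → ℕ) →
  ∑ (upTo (m * n)) g ≡ ∑ (upTo m) (λ a → ∑ (upTo n) (λ b → g (a * n + b)))
∑-upTo-* zero    n g = refl
∑-upTo-* (suc m) n g = begin
  ∑ (upTo (n + m * n)) g
    ≡⟨ ∑-upTo-+ n (m * n) g ⟩
  ∑ (upTo n) g + ∑ (upTo (m * n)) (g ∘ (n +_))
    ≡⟨ cong (∑ (upTo n) g +_) (∑-upTo-* m n (g ∘ (n +_))) ⟩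
  ∑ (upTo n) g + ∑ (upTo m) (λ a → ∑ (upTo n) (λ b → g (n + (a * n + b))))
    ≡⟨ cong (∑ (upTo n) g +_) (∑-cong (upTo m) λ a → ∑-cong (upTo n) λ b →
         cong g (sym (+-assoc n (a * n) b))) ⟩
  ∑ (upTo n) g + ∑ (upTo m) (λ a → ∑ (upTo n) (λ b → g (suc a * n + b)))
    ≡⟨ ∑-upTo-suc m (λ a → ∑ (upTo n) (λ b → g (a * n + b))) ⟨
  ∑ (upTo (suc m)) (λ a → ∑ (upTo n) (λ b → g (a * n + b))) ∎
  where open ≡-Reasoning

any-true : (p : X → Bool) (xs : List X) → T (any p xs) → ∃ λ x → x ∈ xs × T (p x)
any-true p xs t = find (Anyₚ.any⁻ p xs t)

any-intro : (p : X → Bool) {xs : List X} {x : X} → x ∈ xs → T (p x) → T (any p xs)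
any-intro p x∈ px = Anyₚ.any⁺ p (lose x∈ px)

⟦⟧≡0 : ∀ {b} → ¬ T b → ⟦ b ⟧ ≡ 0
⟦⟧≡0 {true}  ¬t = ⊥-elim (¬t tt)
⟦⟧≡0 {false} ¬t = refl

⟦⟧≤1 : ∀ b → ⟦ b ⟧ ≤ 1
⟦⟧≤1 true  = ≤-refl
⟦⟧≤1 false = z≤n

⟦⟧-mono : ∀ {b c} → (T b → T c) → ⟦ b ⟧ ≤ ⟦ c ⟧
⟦⟧-mono {true}  {true}  i = ≤-refl
⟦⟧-mono {true}  {false} i = ⊥-elim (i tt)
⟦⟧-mono {false} {c}     i = z≤n

-- Selections of k elements and a lower bound for binomial coefficients

-- The order of the list is kept, so over a sorted list these are increasing vectors, as a selection
-- of rows requires.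
subs : ∀ k → List X → List (Vec X k)
subs zero    xs       = [ [] ]
subs (suc k) []       = []
subs (suc k) (x ∷ xs) = map (x ∷_) (subs k xs) ++ subs (suc k) xs

allᵛ : ∀ {k} → (X → Bool) → Vec X k → Bool
allᵛ Q []      = true
allᵛ Q (x ∷ v) = Q x ∧ allᵛ Q v

allᵛ-lookup : ∀ {k} (Q : X → Bool) (v : Vec X k) → T (allᵛ Q v) → ∀ i → T (Q (lookup v i))
allᵛ-lookup Q (x ∷ v) t zero    = proj₁ (Equivalence.to T-∧ t)
allᵛ-lookup Q (x ∷ v) t (suc i) = allᵛ-lookup Q v (proj₂ (Equivalence.to T-∧ t)) i

allᵛ-cong : ∀ {k} {Q Q′ : X → Bool} → (∀ x → Q x ≡ Q′ x) → (v : Vec X k) → allᵛ Q v ≡ allᵛ Q′ v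
allᵛ-cong eq []      = refl
allᵛ-cong eq (x ∷ v) = cong₂ _∧_ (eq x) (allᵛ-cong eq v)

∈-subs-∷ : ∀ {k} x (xs : List X) {v : Vec X (suc k)} → v ∈ subs (suc k) (x ∷ xs) →
  (∃ λ w → w ∈ subs k xs × v ≡ x ∷ w) ⊎ v ∈ subs (suc k) xs
∈-subs-∷ {k = k} x xs v∈ with ∈-++⁻ (map (x ∷_) (subs k xs)) v∈
... | inj₁ p = inj₁ (∈-map⁻ (x ∷_) p)
... | inj₂ p = inj₂ p

subs-all : ∀ {P : X → Set} k (xs : List X) {v} → v ∈ subs k xs → ListAll.All P xs → All P v
subs-all zero    xs       (here refl) ps       = []
subs-all (suc k) (x ∷ xs) v∈          (p ∷ ps) with ∈-subs-∷ x xs v∈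
... | inj₁ (w , w∈ , refl) = p ∷ subs-all k xs w∈ ps
... | inj₂ v∈′             = subs-all (suc k) xs v∈′ ps

subs-sorted : ∀ {_~_ : X → X → Set} k (xs : List X) {v} → v ∈ subs k xs →
  ListAllPairs.AllPairs _~_ xs → AllPairs _~_ v
subs-sorted zero    xs       (here refl) s       = []
subs-sorted (suc k) (x ∷ xs) v∈          (r ∷ s) with ∈-subs-∷ x xs v∈
... | inj₁ (w , w∈ , refl) = subs-all k xs w∈ r ∷ subs-sorted k xs w∈ s
... | inj₂ v∈′             = subs-sorted (suc k) xs v∈′ s

length-subs : ∀ k (xs : List X) → length (subs k xs) ≤ length xs ^ k
length-subs zero    xs       = ≤-refl
length-subs (suc k) []       = z≤n
length-subs (suc k) (x ∷ xs) = begin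
  length (map (x ∷_) (subs k xs) ++ subs (suc k) xs)
    ≡⟨ Listₚ.length-++ (map (x ∷_) (subs k xs)) ⟩
  length (map (x ∷_) (subs k xs)) + length (subs (suc k) xs)
    ≡⟨ cong (_+ length (subs (suc k) xs)) (Listₚ.length-map (x ∷_) (subs k xs)) ⟩
  length (subs k xs) + length (subs (suc k) xs)
    ≤⟨ +-mono-≤ (length-subs k xs) (length-subs (suc k) xs) ⟩
  suc n * n ^ k
    ≤⟨ *-monoʳ-≤ (suc n) (^-monoˡ-≤ k (n≤1+n n)) ⟩
  suc n ^ suc k ∎
  where
  open ≤-Reasoning
  n = length xs

∑-subs-∷ : ∀ k (x : X) xs (g : Vec X (suc k) → ℕ) →
  ∑ (subs (suc k) (x ∷ xs)) g ≡ ∑ (subs k xs) (g ∘ (x ∷_)) + ∑ (subs (suc k) xs) g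
∑-subs-∷ k x xs g =
  trans (∑-++ (map (x ∷_) (subs k xs)) _ g)
        (cong (_+ ∑ (subs (suc k) xs) g) (∑-map (x ∷_) (subs k xs) g))

-- A binomial coefficient, kept as a sum over selections so that it can be exchanged with sums over
-- points.
#subs : (X → Bool) → ∀ k → List X → ℕ
#subs Q k xs = ∑ (subs k xs) (λ v → ⟦ allᵛ Q v ⟧)

#subs-∷-true : ∀ (Q : X → Bool) k x xs → Q x ≡ true →
  #subs Q (suc k) (x ∷ xs) ≡ #subs Q k xs + #subs Q (suc k) xs
#subs-∷-true Q k x xs eq = trans (∑-subs-∷ k x xs _)
  (cong (_+ #subs Q (suc k) xs) (∑-cong (subs k xs) λ v → cong (λ b → ⟦ b ∧ allᵛ Q v ⟧) eq))

#subs-∷-false : ∀ (Q : X → Bool) k x xs → Q x ≡ false →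
  #subs Q (suc k) (x ∷ xs) ≡ #subs Q (suc k) xs
#subs-∷-false Q k x xs eq = trans (∑-subs-∷ k x xs _)
  (cong (_+ #subs Q (suc k) xs)
    (∑-zero∈ (subs k xs) λ {v} _ → cong (λ b → ⟦ b ∧ allᵛ Q v ⟧) eq))

#subs-1 : ∀ (Q : X → Bool) xs → #subs Q 1 xs ≡ ∑ xs (⟦_⟧ ∘ Q)
#subs-1 Q []       = refl
#subs-1 Q (x ∷ xs) = by-head (Q x) refl
  where
  by-head : ∀ b → Q x ≡ b → #subs Q 1 (x ∷ xs) ≡ ∑ (x ∷ xs) (⟦_⟧ ∘ Q)
  by-head true  eq = trans (#subs-∷-true Q 0 x xs eq)
    (cong₂ _+_ (cong ⟦_⟧ (sym eq)) (#subs-1 Q xs))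
  by-head false eq = trans (#subs-∷-false Q 0 x xs eq)
    (cong₂ _+_ (cong ⟦_⟧ (sym eq)) (#subs-1 Q xs))

-- Linear lower bound C(a, k + 1) ≥ D ^ k (a - (k + 1) D), where a counts the elements
-- satisfying Q; the free parameter D replaces the convexity of the binomial coefficient.
#subs-tangent : ∀ (Q : X → Bool) D k xs →
  ∑ xs (⟦_⟧ ∘ Q) * D ^ k ≤ #subs Q (suc k) xs + suc k * D ^ suc k
#subs-tangent Q D k []       = z≤n
#subs-tangent Q D k (x ∷ xs) with Q x in eq
... | false = ≤-trans (#subs-tangent Q D k xs)
  (≤-reflexive (cong (_+ suc k * D ^ suc k) (sym (#subs-∷-false Q k x xs eq))))
... | true with ≤-total (suc (∑ xs (⟦_⟧ ∘ Q))) (suc k * D)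
... | inj₁ small = begin
  suc (∑ xs (⟦_⟧ ∘ Q)) * D ^ k                 ≤⟨ *-monoˡ-≤ (D ^ k) small ⟩
  suc k * D * D ^ k                            ≡⟨ *-assoc (suc k) D (D ^ k) ⟩
  suc k * D ^ suc k                            ≤⟨ m≤n+m (suc k * D ^ suc k) (#subs Q (suc k) (x ∷ xs)) ⟩
  #subs Q (suc k) (x ∷ xs) + suc k * D ^ suc k ∎
  where open ≤-Reasoning
... | inj₂ large with m≤n⇒m<n∨m≡n large
... | inj₂ eq′ = begin
  suc (∑ xs (⟦_⟧ ∘ Q)) * D ^ k                 ≡⟨ cong (_* D ^ k) (sym eq′) ⟩
  suc k * D * D ^ k                            ≡⟨ *-assoc (suc k) D (D ^ k) ⟩
  suc k * D ^ suc k                            ≤⟨ m≤n+m (suc k * D ^ suc k) (#subs Q (suc k) (x ∷ xs)) ⟩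
  #subs Q (suc k) (x ∷ xs) + suc k * D ^ suc k ∎
  where open ≤-Reasoning
-- Up to the zero (k + 1) D of the tangent the constant term was enough. Beyond it a new element
-- raises the left side by `D ^ k` and the right side by the number of `k`-subsets; `increment`
-- compares the two by the same bound one degree lower.
... | inj₁ (s≤s large′) = begin
  D ^ k + a * D ^ k                                            ≤⟨ +-mono-≤ (increment k large′) (#subs-tangent Q D k xs) ⟩
  #subs Q k xs + (#subs Q (suc k) xs + suc k * D ^ suc k)      ≡⟨ +-assoc (#subs Q k xs) _ _ ⟨
  #subs Q k xs + #subs Q (suc k) xs + suc k * D ^ suc k        ≡⟨ cong (_+ suc k * D ^ suc k) (#subs-∷-true Q k x xs eq) ⟨
  #subs Q (suc k) (x ∷ xs) + suc k * D ^ suc k                 ∎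
  where
  open ≤-Reasoning
  a = ∑ xs (⟦_⟧ ∘ Q)
  increment : ∀ k → suc k * D ≤ a → D ^ k ≤ #subs Q k xs
  increment zero     _ = ≤-refl
  increment (suc k′) h = +-cancelʳ-≤ (suc k′ * D ^ suc k′) _ _ (begin
    D ^ suc k′ + suc k′ * D ^ suc k′       ≡⟨ *-assoc (suc (suc k′)) D (D ^ k′) ⟨
    suc (suc k′) * D * D ^ k′              ≤⟨ *-monoˡ-≤ (D ^ k′) h ⟩
    a * D ^ k′                             ≤⟨ #subs-tangent Q D k′ xs ⟩
    #subs Q (suc k′) xs + suc k′ * D ^ suc k′ ∎)

-- Powers, grid points and their division into blocks

^-distribʳ-* : ∀ j a b → (a * b) ^ j ≡ a ^ j * b ^ j
^-distribʳ-* zero    a b = refl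
^-distribʳ-* (suc j) a b =
  trans (cong (a * b *_) (^-distribʳ-* j a b)) (interchange a b (a ^ j) (b ^ j))
  where
  interchange : ∀ a b x y → a * b * (x * y) ≡ a * x * (b * y)
  interchange = solve-∀

^-cancelʳ-≤ : ∀ e .{{_ : NonZero e}} {a b} → a ^ e ≤ b ^ e → a ≤ b
^-cancelʳ-≤ e {a} {b} le with ≤-total a b
... | inj₁ a≤b = a≤b
... | inj₂ b≤a with m≤n⇒m<n∨m≡n b≤a
... | inj₁ b<a  = contradiction (<-≤-trans (^-monoˡ-< e b<a) le) (<-irrefl refl)
... | inj₂ refl = ≤-refl

^-swap : ∀ a m n → (a ^ m) ^ n ≡ (a ^ n) ^ m
^-swap a m n = trans (^-*-assoc a m n) (trans (cong (a ^_) (*-comm m n)) (sym (^-*-assoc a n m)))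

pts : ∀ d → ℕ → List (Vec ℕ d)
pts zero    n = [ [] ]
pts (suc d) n = cartesianProductWith _∷_ (upTo n) (pts d n)

length-pts : ∀ d n → length (pts d n) ≡ n ^ d
length-pts zero    n = refl
length-pts (suc d) n =
  trans (length-cartesian _∷_ (upTo n) (pts d n)) (cong₂ _*_ (Listₚ.length-upTo n) (length-pts d n))

∑-pts-suc : ∀ d n (g : Vec ℕ (suc d) → ℕ) →
  ∑ (pts (suc d) n) g ≡ ∑ (upTo n) (λ x → ∑ (pts d n) (λ y → g (x ∷ y)))
∑-pts-suc d n g = ∑-cartesian _∷_ (upTo n) (pts d n) g

∷∈pts : ∀ {d n x} {y : Vec ℕ d} → x < n → y ∈ pts d n → (x ∷ y) ∈ pts (suc d) n
∷∈pts x<n y∈ = ∈-cartesianProductWith⁺ _∷_ (∈-upTo⁺ x<n) y∈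

∷∈pts⁻ : ∀ {d n x} {y : Vec ℕ d} → (x ∷ y) ∈ pts (suc d) n → x < n × y ∈ pts d n
∷∈pts⁻ {d} {n} p with ∈-cartesianProductWith⁻ _∷_ (upTo n) (pts d n) p
... | _ , _ , x∈ , y∈ , refl = ∈-upTo⁻ x∈ , y∈

lookup-pts : ∀ {d n} {y : Vec ℕ d} → y ∈ pts d n → ∀ ℓ → lookup y ℓ < n
lookup-pts {y = _ ∷ _} y∈ zero    = proj₁ (∷∈pts⁻ y∈)
lookup-pts {y = _ ∷ _} y∈ (suc ℓ) = lookup-pts (proj₂ (∷∈pts⁻ y∈)) ℓ

inBlock : ∀ {d} → ℕ → Vec ℕ d → Vec ℕ d → Vec ℕ d
inBlock n = zipWith (λ a c → a * n + c)

lookup-inBlock : ∀ {d} n (b y : Vec ℕ d) ℓ → lookup (inBlock n b y) ℓ ≡ lookup b ℓ * n + lookup y ℓ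
lookup-inBlock n b y ℓ = Vecₚ.lookup-zipWith _ ℓ b y

block-< : ∀ {a b c n} d → a < b → c < n → a * n + c < b * n + d
block-< {a} {b} {c} {n} d a<b c<n = begin-strict
  a * n + c     <⟨ +-monoʳ-< (a * n) c<n ⟩
  a * n + n     ≡⟨ +-comm (a * n) n ⟩
  suc a * n     ≤⟨ *-monoˡ-≤ n a<b ⟩
  b * n         ≤⟨ m≤m+n (b * n) d ⟩
  b * n + d     ∎
  where open ≤-Reasoning

block-bound : ∀ {a m c n} → a < m → c < n → a * n + c < m * n
block-bound {a} {m} {c} {n} a<m c<n = subst (a * n + c <_) (+-identityʳ (m * n)) (block-< 0 a<m c<n)

inBlock∈pts : ∀ {d m n} {b y : Vec ℕ d} → b ∈ pts d m → y ∈ pts d n → inBlock n b y ∈ pts d (m * n)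
inBlock∈pts         {b = []}    {[]}    b∈ y∈ = here refl
inBlock∈pts {m = m} {b = _ ∷ _} {_ ∷ _} b∈ y∈ =
  let b<m , b∈′ = ∷∈pts⁻ {n = m} b∈
      y<n , y∈′ = ∷∈pts⁻ y∈
  in  ∷∈pts (block-bound b<m y<n) (inBlock∈pts b∈′ y∈′)

∑-pts-blocks : ∀ d m n (g : Vec ℕ d → ℕ) →
  ∑ (pts d (m * n)) g ≡ ∑ (pts d m) (λ b → ∑ (pts d n) (λ y → g (inBlock n b y)))
∑-pts-blocks zero    m n g = sym (+-identityʳ _)
∑-pts-blocks (suc d) m n g = begin
  ∑ (pts (suc d) (m * n)) g
    ≡⟨ ∑-pts-suc d (m * n) g ⟩
  ∑ (upTo (m * n)) (λ x → ∑ (pts d (m * n)) (λ y → g (x ∷ y)))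
    ≡⟨ ∑-upTo-* m n _ ⟩
  ∑ (upTo m) (λ a → ∑ (upTo n) (λ c → ∑ (pts d (m * n)) (λ y → g (a * n + c ∷ y))))
    ≡⟨ ∑-cong (upTo m) (λ a → ∑-cong (upTo n) λ c → ∑-pts-blocks d m n _) ⟩
  ∑ (upTo m) (λ a → ∑ (upTo n) (λ c → ∑ (pts d m) (λ b → ∑ (pts d n) (h a c b))))
    ≡⟨ ∑-cong (upTo m) (λ a → ∑-swap (upTo n) (pts d m) _) ⟩
  ∑ (upTo m) (λ a → ∑ (pts d m) (λ b → ∑ (upTo n) (λ c → ∑ (pts d n) (h a c b))))
    ≡⟨ ∑-cong (upTo m) (λ a → ∑-cong (pts d m) λ b → sym (∑-pts-suc d n _)) ⟩
  ∑ (upTo m) (λ a → ∑ (pts d m) (λ b → ∑ (pts (suc d) n) (λ y → g (inBlock n (a ∷ b) y))))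
    ≡⟨ ∑-pts-suc d m _ ⟨
  ∑ (pts (suc d) m) (λ b → ∑ (pts (suc d) n) (λ y → g (inBlock n b y))) ∎
  where
  open ≡-Reasoning
  h : ℕ → ℕ → Vec ℕ d → Vec ℕ d → ℕ
  h a c b y = g (a * n + c ∷ inBlock n b y)

-- Occurrences of patterns and a weak Marcus-Tardos bound

-- A matrix is now a predicate on all integer points, with the side as a separate argument: a block
-- is a composition with `inBlock`, and a change of side needs no conversion of indices.
count : ∀ {d} → (Vec ℕ d → Bool) → ℕ → ℕ
count {d} A n = ∑ (pts d n) (⟦_⟧ ∘ A)

-- A condition on several layers at once becomes a matrix of one dimension less; both inductions on
-- the dimension rest on this.
slice : ∀ {d k} → Vec ℕ k → (Vec ℕ (suc d) → Bool) → Vec ℕ d → Bool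
slice v A y = allᵛ (λ x → A (x ∷ y)) v

upTo-sorted : ∀ n → ListAllPairs.AllPairs _<_ (upTo n)
upTo-sorted n = ListAllPairsₚ.applyUpTo⁺₁ id n λ i<j _ → i<j

upTo-bounded : ∀ n → ListAll.All (_< n) (upTo n)
upTo-bounded n = ListAll.tabulate ∈-upTo⁻

sorted-lookup : ∀ {k} {_~_ : X → X → Set} {v : Vec X k} → AllPairs _~_ v →
  ∀ i j → i Fin.< j → lookup v i ~ lookup v j
sorted-lookup (r ∷ s) zero    (suc j) _         = VecAllₚ.lookup⁺ r j
sorted-lookup (r ∷ s) (suc i) (suc j) (s≤s i<j) = sorted-lookup s i j i<j

-- The elements of I are the ones of a pattern and π ℓ i is the ℓ-th coordinate
-- of i; several ones may share a coordinate, in which case their images are not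
-- compared in that coordinate.

Occurs : ∀ {d k} {I : Set} → (Fin d → I → Fin k) → ℕ → (Vec ℕ d → Bool) → Set
Occurs {d} {I = I} π n A = ∃ λ (y : I → Vec ℕ d) →
  (∀ i → y i ∈ pts d n × T (A (y i))) ×
  (∀ ℓ i j → π ℓ i Fin.< π ℓ j → lookup (y i) ℓ < lookup (y j) ℓ)

nonemptyBlock : ∀ {d} → ℕ → (Vec ℕ d → Bool) → Vec ℕ d → Bool
nonemptyBlock {d} s A b = any (λ y → A (inBlock s b y)) (pts d s)

-- Any choice of ones in the blocks works: blocks with strictly ordered positions keep their points
-- in that order, and equal positions are never compared.
nonemptyBlock-occurs : ∀ {d k m s} {I : Set} (π : Fin d → I → Fin k) (A : Vec ℕ d → Bool) →
  Occurs π m (nonemptyBlock s A) → Occurs π (m * s) A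
nonemptyBlock-occurs {d} {m = m} {s} π A (b , b∈ , b<) =
  y , (λ i → inBlock∈pts (proj₁ (b∈ i)) (proj₁ (proj₂ (pt i))) , proj₂ (proj₂ (pt i))) , y<
  where
  pt : ∀ i → ∃ λ y → y ∈ pts d s × T (A (inBlock s (b i) y))
  pt i = any-true _ (pts d s) (proj₂ (b∈ i))
  y : _ → Vec ℕ d
  y i = inBlock s (b i) (proj₁ (pt i))
  y< : ∀ ℓ i j → π ℓ i Fin.< π ℓ j → lookup (y i) ℓ < lookup (y j) ℓ
  y< ℓ i j lt = subst₂ _<_ (sym (lookup-inBlock s (b i) _ ℓ)) (sym (lookup-inBlock s (b j) _ ℓ))
    (block-< _ (b< ℓ i j lt) (lookup-pts (proj₁ (proj₂ (pt i))) ℓ))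

-- For fixed `b₀`, the slice of this matrix by `v` marks the blocks that meet every layer of `v`,
-- the wide blocks of the Marcus-Tardos argument.
rowHit : ∀ {d} → ℕ → (Vec ℕ (suc d) → Bool) → ℕ → Vec ℕ (suc d) → Bool
rowHit {d} s A b₀ (x ∷ b) = any (λ y → A (b₀ * s + x ∷ inBlock s b y)) (pts d s)

-- All first coordinates come from one row of blocks: since each block used meets every layer of
-- `v`, the layer of `i` can be the `π zero i`-th element of `v`. Only the other coordinates have to
-- be supplied by the positions of the blocks.
rowHit-occurs : ∀ {d k m s b₀} {I : Set} (π : Fin (suc d) → I → Fin k) (A : Vec ℕ (suc d) → Bool) →
  b₀ < m → (v : Vec ℕ k) → v ∈ subs k (upTo s) →
  Occurs (π ∘ suc) m (slice v (rowHit s A b₀)) → Occurs π (m * s) A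
rowHit-occurs {d} {k} {m} {s} {b₀} π A b₀<m v v∈ (b , b∈ , b<) =
  y , (λ i → ∷∈pts (block-bound b₀<m (VecAllₚ.lookup⁺ v< (π zero i)))
                   (inBlock∈pts (proj₁ (b∈ i)) (proj₁ (proj₂ (pt i)))) , proj₂ (proj₂ (pt i))) , y<
  where
  v< : All (_< s) v
  v< = subs-all k (upTo s) v∈ (upTo-bounded s)
  pt : ∀ i → ∃ λ y → y ∈ pts d s × T (A (b₀ * s + lookup v (π zero i) ∷ inBlock s (b i) y))
  pt i = any-true _ (pts d s) (allᵛ-lookup _ v (proj₂ (b∈ i)) (π zero i))
  y : _ → Vec ℕ (suc d)
  y i = b₀ * s + lookup v (π zero i) ∷ inBlock s (b i) (proj₁ (pt i))
  y< : ∀ ℓ i j → π ℓ i Fin.< π ℓ j → lookup (y i) ℓ < lookup (y j) ℓ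
  y< zero    i j lt = +-monoʳ-< (b₀ * s)
    (sorted-lookup (subs-sorted k (upTo s) v∈ (upTo-sorted s)) (π zero i) (π zero j) lt)
  y< (suc ℓ) i j lt = subst₂ _<_ (sym (lookup-inBlock s (b i) _ ℓ)) (sym (lookup-inBlock s (b j) _ ℓ))
    (block-< _ (b< ℓ i j lt) (lookup-pts (proj₁ (proj₂ (pt i))) ℓ))

∑⟦⟧≤ : (Q : X → Bool) (xs : List X) → ∑ xs (⟦_⟧ ∘ Q) ≤ length xs * ⟦ any Q xs ⟧
∑⟦⟧≤ Q xs = ∑-bound xs λ x∈ → ⟦⟧-mono (any-intro Q x∈)

-- This is `#subs-tangent` with `D` = 1: beyond `suc k` elements, each further one is paid for by a
-- selection. The indicator makes an empty block cost nothing.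
few-or-subs : ∀ (Q : X → Bool) k xs →
  ∑ xs (⟦_⟧ ∘ Q) ≤ suc k * ⟦ any Q xs ⟧ + #subs Q (suc k) xs
few-or-subs Q k xs with any Q xs in eq
... | false = ≤-trans (∑⟦⟧≤ Q xs)
  (≤-trans (≤-reflexive (trans (cong (λ b → length xs * ⟦ b ⟧) eq) (*-zeroʳ (length xs)))) z≤n)
... | true = begin
  ∑ xs (⟦_⟧ ∘ Q)                         ≡⟨ *-identityʳ _ ⟨
  ∑ xs (⟦_⟧ ∘ Q) * 1                     ≡⟨ cong (∑ xs (⟦_⟧ ∘ Q) *_) (^-zeroˡ k) ⟨
  ∑ xs (⟦_⟧ ∘ Q) * 1 ^ k                 ≤⟨ #subs-tangent Q 1 k xs ⟩
  #subs Q (suc k) xs + suc k * 1 ^ suc k ≡⟨ cong (λ t → #subs Q (suc k) xs + suc k * t) (^-zeroˡ (suc k)) ⟩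
  #subs Q (suc k) xs + suc k * 1         ≡⟨ +-comm (#subs Q (suc k) xs) _ ⟩
  suc k * 1 + #subs Q (suc k) xs         ∎
  where open ≤-Reasoning

-- A block has at most `s ^ d` ones in each layer that it meets, and `few-or-subs` counts those
-- layers.
count-blocks-≤ : ∀ {d} k m s (A : Vec ℕ (suc d) → Bool) →
  count A (m * s) ≤ s ^ d * (suc k * count (nonemptyBlock s A) m
    + ∑ (upTo m) (λ b₀ → ∑ (subs (suc k) (upTo s)) (λ v → count (slice v (rowHit s A b₀)) m)))
count-blocks-≤ {d} k m s A = begin
  count A (m * s)
    ≡⟨ ∑-pts-blocks (suc d) m s _ ⟩
  ∑ (pts (suc d) m) (λ b → ∑ (pts (suc d) s) (λ y → ⟦ A (inBlock s b y) ⟧))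
    ≡⟨ ∑-pts-suc d m _ ⟩
  ∑ (upTo m) (λ b₀ → ∑ (pts d m) (λ b → ∑ (pts (suc d) s) (λ y → ⟦ A (inBlock s (b₀ ∷ b) y) ⟧)))
    ≤⟨ ∑-mono (upTo m) (λ b₀ → ∑-mono (pts d m) (per-block b₀)) ⟩
  ∑ (upTo m) (λ b₀ → ∑ (pts d m) (λ b → s ^ d * (suc k * ⟦ B (b₀ ∷ b) ⟧ + wide b₀ b)))
    ≡⟨ ∑-cong (upTo m) (λ b₀ → trans (∑-*ˡ (pts d m) (s ^ d) _) (cong (s ^ d *_)
         (trans (∑-+ (pts d m) _ (wide b₀))
                (cong₂ _+_ (∑-*ˡ (pts d m) (suc k) _) (∑-swap (pts d m) (subs (suc k) (upTo s)) _))))) ⟩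
  ∑ (upTo m) (λ b₀ → s ^ d * (suc k * ∑ (pts d m) (λ b → ⟦ B (b₀ ∷ b) ⟧)
                              + ∑ (subs (suc k) (upTo s)) (λ v → count (slice v (rowHit s A b₀)) m)))
    ≡⟨ trans (∑-*ˡ (upTo m) (s ^ d) _) (cong (s ^ d *_)
         (trans (∑-+ (upTo m) _ _) (cong (_+ rest) (∑-*ˡ (upTo m) (suc k) _)))) ⟩
  s ^ d * (suc k * ∑ (upTo m) (λ b₀ → ∑ (pts d m) (λ b → ⟦ B (b₀ ∷ b) ⟧)) + rest)
    ≡⟨ cong (λ t → s ^ d * (suc k * t + rest)) (∑-pts-suc d m _) ⟨
  s ^ d * (suc k * count B m + rest) ∎
  where
  open ≤-Reasoning
  B = nonemptyBlock s A
  rest = ∑ (upTo m) (λ b₀ → ∑ (subs (suc k) (upTo s)) (λ v → count (slice v (rowHit s A b₀)) m))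
  row : ℕ → Vec ℕ d → ℕ → Bool
  row b₀ b x = rowHit s A b₀ (x ∷ b)
  wide : ℕ → Vec ℕ d → ℕ
  wide b₀ b = #subs (row b₀ b) (suc k) (upTo s)
  hit⇒nonempty : ∀ b₀ b → T (any (row b₀ b) (upTo s)) → T (B (b₀ ∷ b))
  hit⇒nonempty b₀ b t =
    let x , x∈ , r  = any-true (row b₀ b) (upTo s) t
        y , y∈ , a = any-true _ (pts d s) r
    in  any-intro _ (∷∈pts (∈-upTo⁻ x∈) y∈) a
  per-block : ∀ b₀ b → ∑ (pts (suc d) s) (λ y → ⟦ A (inBlock s (b₀ ∷ b) y) ⟧) ≤
                       s ^ d * (suc k * ⟦ B (b₀ ∷ b) ⟧ + wide b₀ b)
  per-block b₀ b = begin
    ∑ (pts (suc d) s) (λ y → ⟦ A (inBlock s (b₀ ∷ b) y) ⟧)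
      ≡⟨ ∑-pts-suc d s _ ⟩
    ∑ (upTo s) (λ x → ∑ (pts d s) (λ y → ⟦ A (b₀ * s + x ∷ inBlock s b y) ⟧))
      ≤⟨ ∑-mono (upTo s) (λ x → ∑⟦⟧≤ _ (pts d s)) ⟩
    ∑ (upTo s) (λ x → length (pts d s) * ⟦ row b₀ b x ⟧)
      ≡⟨ ∑-*ˡ (upTo s) (length (pts d s)) _ ⟩
    length (pts d s) * ∑ (upTo s) (⟦_⟧ ∘ row b₀ b)
      ≡⟨ cong (_* ∑ (upTo s) (⟦_⟧ ∘ row b₀ b)) (length-pts d s) ⟩
    s ^ d * ∑ (upTo s) (⟦_⟧ ∘ row b₀ b)
      ≤⟨ *-monoʳ-≤ (s ^ d) (≤-trans (few-or-subs (row b₀ b) k (upTo s))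
           (+-monoˡ-≤ (wide b₀ b) (*-monoʳ-≤ (suc k) (⟦⟧-mono (hit⇒nonempty b₀ b))))) ⟩
    s ^ d * (suc k * ⟦ B (b₀ ∷ b) ⟧ + wide b₀ b) ∎

-- Raising the dimension pays for at most `s ^ suc k` sets of layers; the added 1 covers side 1, the
-- start of the induction on `j`.
patternConst : ℕ → ℕ → ℕ → ℕ
patternConst k s zero    = 0
patternConst k s (suc d) = suc (s ^ suc k * patternConst k s d)

-- Marcus–Tardos argument using only the blocks that are wide in the first
-- coordinate.  This loses a small power of s ^ j compared with the optimal
-- exponent d - 1.
avoid-pattern : ∀ {d} k s {I : Set} (π : Fin d → I → Fin (suc k)) j (A : Vec ℕ d → Bool) →
  ¬ Occurs π (s ^ j) A →
  s ^ j * count A (s ^ j) ≤ patternConst k s d * (suc (suc k) * s ^ d) ^ j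
avoid-pattern {zero}  k s π j A ¬occ =
  ≤-trans (≤-reflexive (cong (λ t → s ^ j * (t + 0)) (⟦⟧≡0 ¬A)))
          (≤-trans (≤-reflexive (*-zeroʳ (s ^ j))) z≤n)
  where
  -- With no coordinates to compare, a single one already gives an occurrence.
  ¬A : ¬ T (A [])
  ¬A t = ¬occ ((λ _ → []) , (λ _ → here refl , t) , λ ())
avoid-pattern {suc d} k s π zero    A ¬occ = begin
  1 * count A 1                                ≡⟨ *-identityˡ _ ⟩
  count A 1                                    ≤⟨ ∑-bound (pts (suc d) 1) (λ {y} _ → ⟦⟧≤1 (A y)) ⟩
  length (pts (suc d) 1) * 1                   ≡⟨ cong (_* 1) (trans (length-pts (suc d) 1) (^-zeroˡ (suc d))) ⟩
  1                                            ≤⟨ s≤s z≤n ⟩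
  patternConst k s (suc d)                     ≡⟨ *-identityʳ _ ⟨
  patternConst k s (suc d) * 1                 ∎
  where open ≤-Reasoning
avoid-pattern {suc d} k s π (suc j) A ¬occ = begin
  s ^ suc j * count A (s ^ suc j)
    ≡⟨ cong (λ t → s ^ suc j * count A t) (*-comm s m) ⟩
  s ^ suc j * count A (m * s)
    ≤⟨ *-monoʳ-≤ (s ^ suc j) (count-blocks-≤ k m s A) ⟩
  s ^ suc j * (s ^ d * (suc k * count B m + rest))
    ≡⟨ rearrange s m (s ^ d) (suc k) (count B m) rest ⟩
  s * s ^ d * (suc k * (m * count B m) + m * rest)
    ≤⟨ *-monoʳ-≤ (s * s ^ d) (+-mono-≤
         (*-monoʳ-≤ (suc k) (avoid-pattern k s π j B ¬occB)) rest≤) ⟩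
  s * s ^ d * (suc k * (c′ * (K * (s * s ^ d)) ^ j) + m * (s ^ suc k * (c * (K * s ^ d) ^ j)))
    ≡⟨ cong (λ t → s * s ^ d * (suc k * (c′ * (K * (s * s ^ d)) ^ j) + t)) absorb ⟩
  s * s ^ d * (suc k * (c′ * (K * (s * s ^ d)) ^ j) + (s ^ suc k * c) * (K * (s * s ^ d)) ^ j)
    ≤⟨ *-monoʳ-≤ (s * s ^ d) (+-monoʳ-≤ _ (*-monoˡ-≤ ((K * (s * s ^ d)) ^ j) (n≤1+n (s ^ suc k * c)))) ⟩
  s * s ^ d * (suc k * (c′ * (K * (s * s ^ d)) ^ j) + c′ * (K * (s * s ^ d)) ^ j)
    ≡⟨ collect (s * s ^ d) k c′ ((K * (s * s ^ d)) ^ j) ⟩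
  c′ * (K * (s * s ^ d)) ^ suc j ∎
  where
  open ≤-Reasoning
  m = s ^ j
  -- The contracted matrix of nonempty blocks (induction on `j`) contributes the factor `suc k`. The
  -- wide blocks (induction on the dimension) contribute the remaining unit, because `c′` exceeds
  -- `s ^ suc k * c`.
  K = suc (suc k)
  c = patternConst k s d
  c′ = patternConst k s (suc d)
  B = nonemptyBlock s A
  rest = ∑ (upTo m) (λ b₀ → ∑ (subs (suc k) (upTo s)) (λ v → count (slice v (rowHit s A b₀)) m))
  ¬occB : ¬ Occurs π m B
  ¬occB o = ¬occ (subst (λ t → Occurs π t A) (*-comm m s) (nonemptyBlock-occurs {m = m} {s} π A o))
  slice≤ : ∀ {b₀ v} → b₀ < m → v ∈ subs (suc k) (upTo s) →
           m * count (slice v (rowHit s A b₀)) m ≤ c * (K * s ^ d) ^ j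
  slice≤ {b₀} {v} b₀<m v∈ = avoid-pattern k s (π ∘ suc) j (slice v (rowHit s A b₀)) λ o →
    ¬occ (subst (λ t → Occurs π t A) (*-comm m s) (rowHit-occurs π A b₀<m v v∈ o))
  #subs≤ : length (subs (suc k) (upTo s)) ≤ s ^ suc k
  #subs≤ = subst (λ t → length (subs (suc k) (upTo s)) ≤ t ^ suc k) (Listₚ.length-upTo s)
                 (length-subs (suc k) (upTo s))
  rest≤ : m * rest ≤ m * (s ^ suc k * (c * (K * s ^ d) ^ j))
  rest≤ = begin
    m * rest
      ≡⟨ trans (sym (∑-*ˡ (upTo m) m _)) (∑-cong (upTo m) λ b₀ → sym (∑-*ˡ (subs (suc k) (upTo s)) m _)) ⟩
    ∑ (upTo m) (λ b₀ → ∑ (subs (suc k) (upTo s)) (λ v → m * count (slice v (rowHit s A b₀)) m))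
      ≤⟨ ∑-bound (upTo m) (λ b₀∈ → ≤-trans (∑-bound (subs (suc k) (upTo s)) (slice≤ (∈-upTo⁻ b₀∈)))
           (*-monoˡ-≤ (c * (K * s ^ d) ^ j) #subs≤)) ⟩
    length (upTo m) * (s ^ suc k * (c * (K * s ^ d) ^ j))
      ≡⟨ cong (_* (s ^ suc k * (c * (K * s ^ d) ^ j))) (Listₚ.length-upTo m) ⟩
    m * (s ^ suc k * (c * (K * s ^ d) ^ j)) ∎
  rearrange : ∀ s m sd k x r →
    s * m * (sd * (k * x + r)) ≡ s * sd * (k * (m * x) + m * r)
  rearrange = solve-∀
  absorb : m * (s ^ suc k * (c * (K * s ^ d) ^ j)) ≡ (s ^ suc k * c) * (K * (s * s ^ d)) ^ j
  absorb = begin-equality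
    m * (s ^ suc k * (c * (K * s ^ d) ^ j))   ≡⟨ shuffle m (s ^ suc k) c ((K * s ^ d) ^ j) ⟩
    (s ^ suc k * c) * (m * (K * s ^ d) ^ j)   ≡⟨ cong ((s ^ suc k * c) *_) (^-distribʳ-* j s (K * s ^ d)) ⟨
    (s ^ suc k * c) * (s * (K * s ^ d)) ^ j   ≡⟨ cong (λ t → (s ^ suc k * c) * t ^ j) (comm₃ s K (s ^ d)) ⟩
    (s ^ suc k * c) * (K * (s * s ^ d)) ^ j   ∎
    where
    shuffle : ∀ m t c x → m * (t * (c * x)) ≡ (t * c) * (m * x)
    shuffle = solve-∀
    comm₃ : ∀ s k x → s * (k * x) ≡ k * (s * x)
    comm₃ = solve-∀
  collect : ∀ a k c x → a * (suc k * (c * x) + c * x) ≡ c * (suc (suc k) * a * x)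
  collect = solve-∀

-- Full boxes: supersaturation and the Kővári-Sós-Turán bound

Box : ∀ {d} → Set → Vec ℕ d → Set
Box X = All (Vec X)

boxes : ∀ {d} (ks : Vec ℕ d) → List X → List (Box X ks)
boxes []       xs = [ [] ]
boxes (k ∷ ks) xs = cartesianProductWith _∷_ (subs k xs) (boxes ks xs)

length-boxes : ∀ {d} (ks : Vec ℕ d) (xs : List X) → length (boxes ks xs) ≤ length xs ^ sum ks
length-boxes []       xs = ≤-refl
length-boxes (k ∷ ks) xs = begin
  length (boxes (k ∷ ks) xs)                ≡⟨ length-cartesian _∷_ (subs k xs) (boxes ks xs) ⟩
  length (subs k xs) * length (boxes ks xs) ≤⟨ *-mono-≤ (length-subs k xs) (length-boxes ks xs) ⟩
  length xs ^ k * length xs ^ sum ks        ≡⟨ ^-distribˡ-+-* (length xs) k (sum ks) ⟨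
  length xs ^ (k + sum ks)                  ∎
  where open ≤-Reasoning

length-subs-upTo : ∀ k n → length (subs k (upTo n)) ≤ n ^ k
length-subs-upTo k n =
  subst (λ t → length (subs k (upTo n)) ≤ t ^ k) (Listₚ.length-upTo n) (length-subs k (upTo n))

length-boxes-upTo : ∀ {d} (ks : Vec ℕ d) n → length (boxes ks (upTo n)) ≤ n ^ sum ks
length-boxes-upTo ks n =
  subst (λ t → length (boxes ks (upTo n)) ≤ t ^ sum ks) (Listₚ.length-upTo n) (length-boxes ks (upTo n))

full : ∀ {d} {ks : Vec ℕ d} → Box ℕ ks → (Vec ℕ d → Bool) → Bool
full []      A = A []
full (v ∷ e) A = full e (slice v A)

full-cong : ∀ {d} {ks : Vec ℕ d} (e : Box ℕ ks) {A B : Vec ℕ d → Bool} →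
  (∀ y → A y ≡ B y) → full e A ≡ full e B
full-cong []      eq = eq []
full-cong (v ∷ e) eq = full-cong e λ y → allᵛ-cong (λ x → eq (x ∷ y)) v

allᵛ-∧ : ∀ {k} (P Q : X → Bool) (v : Vec X k) → allᵛ (λ x → P x ∧ Q x) v ≡ allᵛ P v ∧ allᵛ Q v
allᵛ-∧ P Q []      = refl
allᵛ-∧ P Q (x ∷ v) = begin
  (P x ∧ Q x) ∧ allᵛ (λ x → P x ∧ Q x) v ≡⟨ cong ((P x ∧ Q x) ∧_) (allᵛ-∧ P Q v) ⟩
  (P x ∧ Q x) ∧ (allᵛ P v ∧ allᵛ Q v)    ≡⟨ ∧-assoc (P x) (Q x) _ ⟩
  P x ∧ (Q x ∧ (allᵛ P v ∧ allᵛ Q v))    ≡⟨ cong (P x ∧_) (sym (∧-assoc (Q x) (allᵛ P v) _)) ⟩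
  P x ∧ ((Q x ∧ allᵛ P v) ∧ allᵛ Q v)    ≡⟨ cong (λ b → P x ∧ (b ∧ allᵛ Q v)) (∧-comm (Q x) _) ⟩
  P x ∧ ((allᵛ P v ∧ Q x) ∧ allᵛ Q v)    ≡⟨ cong (P x ∧_) (∧-assoc (allᵛ P v) (Q x) _) ⟩
  P x ∧ (allᵛ P v ∧ (Q x ∧ allᵛ Q v))    ≡⟨ ∧-assoc (P x) _ _ ⟨
  (P x ∧ allᵛ P v) ∧ (Q x ∧ allᵛ Q v)    ∎
  where open ≡-Reasoning

allᵛ-true : ∀ {k} (v : Vec X k) → allᵛ (λ _ → true) v ≡ true
allᵛ-true []      = refl
allᵛ-true (x ∷ v) = allᵛ-true v

full-∧ : ∀ {d} {ks : Vec ℕ d} (e : Box ℕ ks) (A B : Vec ℕ d → Bool) →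
  full e (λ y → A y ∧ B y) ≡ full e A ∧ full e B
full-∧ []      A B = refl
full-∧ (v ∷ e) A B =
  trans (full-cong e λ y → allᵛ-∧ (λ x → A (x ∷ y)) (λ x → B (x ∷ y)) v)
        (full-∧ e (slice v A) (slice v B))

full-true : ∀ {d} {ks : Vec ℕ d} (e : Box ℕ ks) → full e (λ _ → true) ≡ true
full-true []      = refl
full-true (v ∷ e) = trans (full-cong e λ _ → allᵛ-true v) (full-true e)

-- `full` resolves the first coordinate innermost. Exchanging the conjunctions resolves it last, so
-- that it can vary over a fixed box in the other coordinates.
full-slice : ∀ {d k} {ks : Vec ℕ d} (e : Box ℕ ks) (v : Vec ℕ k) (A : Vec ℕ (suc d) → Bool) →
  full e (slice v A) ≡ allᵛ (λ x → full e (λ y → A (x ∷ y))) v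
full-slice e []      A = full-true e
full-slice e (x ∷ v) A =
  trans (full-∧ e (λ y → A (x ∷ y)) (slice v A)) (cong (full e (λ y → A (x ∷ y)) ∧_) (full-slice e v A))

copies : ∀ {d} → Vec ℕ d → (Vec ℕ d → Bool) → ℕ → ℕ
copies ks A n = ∑ (boxes ks (upTo n)) (λ e → ⟦ full e A ⟧)

copies-∷ : ∀ {d} k (ks : Vec ℕ d) A n →
  copies (k ∷ ks) A n ≡ ∑ (subs k (upTo n)) (λ v → copies ks (slice v A) n)
copies-∷ k ks A n = ∑-cartesian _∷_ (subs k (upTo n)) (boxes ks (upTo n)) _

-- The tangent bound on every line in the first direction, summed over these lines.
count-tangent : ∀ {d} k D n (A : Vec ℕ (suc d) → Bool) →
  count A n * D ^ k ≤ ∑ (subs (suc k) (upTo n)) (λ v → count (slice v A) n) + suc k * D ^ suc k * n ^ d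
count-tangent {d} k D n A = begin
  count A n * D ^ k
    ≡⟨ cong (_* D ^ k) (trans (∑-pts-suc d n _) (∑-swap (upTo n) (pts d n) _)) ⟩
  ∑ (pts d n) (λ y → ∑ (upTo n) (λ x → ⟦ A (x ∷ y) ⟧)) * D ^ k
    ≡⟨ ∑-*ʳ (pts d n) (D ^ k) _ ⟨
  ∑ (pts d n) (λ y → ∑ (upTo n) (λ x → ⟦ A (x ∷ y) ⟧) * D ^ k)
    ≤⟨ ∑-mono (pts d n) (λ y → #subs-tangent (λ x → A (x ∷ y)) D k (upTo n)) ⟩
  ∑ (pts d n) (λ y → #subs (λ x → A (x ∷ y)) (suc k) (upTo n) + suc k * D ^ suc k)
    ≡⟨ ∑-+ (pts d n) _ _ ⟩
  ∑ (pts d n) (λ y → #subs (λ x → A (x ∷ y)) (suc k) (upTo n)) + ∑ (pts d n) (λ _ → suc k * D ^ suc k)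
    ≡⟨ cong₂ _+_ (∑-swap (pts d n) (subs (suc k) (upTo n)) _)
         (trans (∑-const (pts d n) _) (trans (cong (_* (suc k * D ^ suc k)) (length-pts d n)) (*-comm (n ^ d) _))) ⟩
  ∑ (subs (suc k) (upTo n)) (λ v → count (slice v A) n) + suc k * D ^ suc k * n ^ d ∎
  where open ≤-Reasoning

-- With δ = count A n / n ^ d this says δ z ≤ n · (proportion of boxes that are
-- full) + sum ks: the tangent at δ = 1 / z of the convex bound δ ^ product ks.
supersaturation : ∀ {d} (ks : Vec ℕ d) → All NonZero ks → ∀ z n → z ^ product ks ≡ n →
  (A : Vec ℕ d → Bool) →
  count A n * z * n ^ sum ks ≤ copies ks A n * n * n ^ d + sum ks * n ^ sum ks * n ^ d
supersaturation []       pos        z n eq A rewrite sym eq | *-identityʳ z =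
  ≤-reflexive (base (⟦ A [] ⟧ + 0) z)
  where
  base : ∀ a z → a * z * 1 ≡ a * z * 1 + 0
  base = solve-∀
supersaturation (zero ∷ ks)  (record {nonZero = ()} ∷ pos) z n eq A
supersaturation {suc d} (suc k ∷ ks) (p ∷ pos) z n eq A = begin
  a * z * n ^ (suc k + S)
    ≡⟨ cong (a * z *_) (^-distribˡ-+-* n (suc k) S) ⟩
  a * z * (n * n ^ k * W)
    ≡⟨ cong (λ t → a * z * (n * t * W)) (trans (cong (_^ k) n≡zD) (^-distribʳ-* k z D)) ⟩
  a * z * (n * (z ^ k * D ^ k) * W)
    ≡⟨ expose a z n (z ^ k) (D ^ k) W ⟩
  a * D ^ k * (z ^ suc k * (n * W))
    ≤⟨ *-monoˡ-≤ (z ^ suc k * (n * W)) (count-tangent k D n A) ⟩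
  (V + suc k * D ^ suc k * N) * (z ^ suc k * (n * W))
    ≡⟨ split V (suc k) (D ^ suc k) N (z ^ suc k) n W ⟩
  V * z ^ suc k * W * n + suc k * (z ^ suc k * D ^ suc k) * (N * n * W)
    ≤⟨ +-mono-≤ (*-monoˡ-≤ n slices) (≤-reflexive (cong (λ t → suc k * t * (N * n * W)) zD^)) ⟩
  (cop * n * N + n ^ suc k * (sum ks * W * N)) * n + suc k * n ^ suc k * (N * n * W)
    ≡⟨ gather cop n N (n ^ suc k) (sum ks) W (suc k) ⟩
  cop * n * (n * N) + (suc k + sum ks) * (n ^ suc k * W) * (n * N)
    ≡⟨ cong (λ t → cop * n * (n * N) + (suc k + sum ks) * t * (n * N)) (^-distribˡ-+-* n (suc k) S) ⟨
  cop * n * (n * N) + (suc k + sum ks) * n ^ (suc k + S) * (n * N) ∎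
  where
  open ≤-Reasoning
  instance _ = product≢0 (p ∷ pos)
  S = sum ks
  W = n ^ S
  N = n ^ d
  -- At density 1 / z an average line holds n / z ones. This is `D`, written as a power of `z` to
  -- stay within the integers.
  D = z ^ ℕ.pred (product (suc k ∷ ks))
  a = count A n
  cop = copies (suc k ∷ ks) A n
  V = ∑ (subs (suc k) (upTo n)) (λ v → count (slice v A) n)
  n≡zD : n ≡ z * D
  n≡zD = trans (sym eq) (cong (z ^_) (sym (suc-pred (product (suc k ∷ ks)))))
  zD^ : z ^ suc k * D ^ suc k ≡ n ^ suc k
  zD^ = trans (sym (^-distribʳ-* (suc k) z D)) (cong (_^ suc k) (sym n≡zD))
  slices : V * z ^ suc k * W ≤ cop * n * N + n ^ suc k * (sum ks * W * N)
  slices = begin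
    V * z ^ suc k * W
      ≡⟨ trans (∑-*ʳ vs W _) (cong (_* W) (∑-*ʳ vs (z ^ suc k) _)) ⟨
    ∑ vs (λ v → count (slice v A) n * z ^ suc k * W)
      -- Intersecting `suc k` layers lowers the reference density to 1 / z ^ suc k, and the power
      -- `product ks` of z ^ suc k is again n.
      ≤⟨ ∑-mono vs (λ v → supersaturation ks pos (z ^ suc k) n
           (trans (^-*-assoc z (suc k) (product ks)) eq) (slice v A)) ⟩
    ∑ vs (λ v → copies ks (slice v A) n * n * N + sum ks * W * N)
      ≡⟨ ∑-+ vs _ _ ⟩
    ∑ vs (λ v → copies ks (slice v A) n * n * N) + ∑ vs (λ _ → sum ks * W * N)
      ≡⟨ cong₂ _+_ (trans (∑-*ʳ vs N _) (cong (_* N) (trans (∑-*ʳ vs n _)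
           (cong (_* n) (sym (copies-∷ (suc k) ks A n)))))) (∑-const vs _) ⟩
    cop * n * N + length vs * (sum ks * W * N)
      ≤⟨ +-monoʳ-≤ (cop * n * N) (*-monoˡ-≤ (sum ks * W * N) (length-subs-upTo (suc k) n)) ⟩
    cop * n * N + n ^ suc k * (sum ks * W * N) ∎
    where vs = subs (suc k) (upTo n)
  expose : ∀ a z n x y w → a * z * (n * (x * y) * w) ≡ a * y * (z * x * (n * w))
  expose = solve-∀
  split : ∀ v k y N x n w → (v + k * y * N) * (x * (n * w)) ≡ v * x * w * n + k * (x * y) * (N * n * w)
  split = solve-∀
  gather : ∀ c n N t s w k →
    (c * n * N + t * (s * w * N)) * n + k * t * (N * n * w) ≡ c * n * (n * N) + (k + s) * (t * w) * (n * N)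
  gather = solve-∀

BoxFree : ∀ {d} → Vec ℕ d → ℕ → (Vec ℕ d → Bool) → Set
BoxFree ks n A = ∀ {e} → e ∈ boxes ks (upTo n) → ¬ T (full e A)

boxFree-slice : ∀ {d k n} {ks : Vec ℕ d} {A v} → BoxFree (k ∷ ks) n A → v ∈ subs k (upTo n) →
  BoxFree ks n (slice v A)
boxFree-slice free v∈ e∈ = free (∈-cartesianProductWith⁺ _∷_ v∈ e∈)

no-subs⇒few : ∀ (Q : X → Bool) k xs → #subs Q k xs ≡ 0 → ∑ xs (⟦_⟧ ∘ Q) ≤ k
-- For `k` = 0 the hypothesis is absurd: the empty selection always counts.
no-subs⇒few Q (suc k) xs eq = begin
  ∑ xs (⟦_⟧ ∘ Q)                                ≤⟨ few-or-subs Q k xs ⟩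
  suc k * ⟦ any Q xs ⟧ + #subs Q (suc k) xs     ≡⟨ cong (suc k * ⟦ any Q xs ⟧ +_) eq ⟩
  suc k * ⟦ any Q xs ⟧ + 0                      ≡⟨ +-identityʳ _ ⟩
  suc k * ⟦ any Q xs ⟧                          ≤⟨ *-monoʳ-≤ (suc k) (⟦⟧≤1 (any Q xs)) ⟩
  suc k * 1                                     ≡⟨ *-identityʳ (suc k) ⟩
  suc k                                         ∎
  where open ≤-Reasoning

-- Fix a box in the other coordinates. If more than `lookup ks ℓ` values of coordinate `ℓ` completed
-- it, some of them would span a full box of shape `ks`. So only a proportion of order 1 / n of the
-- shrunken boxes is full.
boxFree⇒few-copies : ∀ {d} (ks : Vec ℕ d) ℓ n A → BoxFree ks n A →
  copies (ks [ ℓ ]≔ 1) A n * n ≤ lookup ks ℓ * n ^ sum (ks [ ℓ ]≔ 1)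
boxFree⇒few-copies (k ∷ ks) zero n A free = begin
  copies (1 ∷ ks) A n * n
    ≡⟨ cong (_* n) (trans (copies-∷ 1 ks A n) (∑-swap (subs 1 (upTo n)) (boxes ks (upTo n)) _)) ⟩
  ∑ (boxes ks (upTo n)) (λ e → ∑ (subs 1 (upTo n)) (λ v → ⟦ full e (slice v A) ⟧)) * n
    ≤⟨ *-monoˡ-≤ n (∑-bound (boxes ks (upTo n)) per-box) ⟩
  length (boxes ks (upTo n)) * k * n
    ≤⟨ *-monoˡ-≤ n (*-monoˡ-≤ k (length-boxes-upTo ks n)) ⟩
  n ^ sum ks * k * n
    ≡⟨ shuffle (n ^ sum ks) k n ⟩
  k * (n * n ^ sum ks) ∎
  where
  open ≤-Reasoning
  shuffle : ∀ x k n → x * k * n ≡ k * (n * x)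
  shuffle = solve-∀
  Q : Box ℕ ks → ℕ → Bool
  Q e x = full e (λ y → A (x ∷ y))
  per-box : ∀ {e} → e ∈ boxes ks (upTo n) → ∑ (subs 1 (upTo n)) (λ v → ⟦ full e (slice v A) ⟧) ≤ k
  per-box {e} e∈ = begin
    ∑ (subs 1 (upTo n)) (λ v → ⟦ full e (slice v A) ⟧)
      ≡⟨ ∑-cong (subs 1 (upTo n)) (λ v → cong ⟦_⟧ (full-slice e v A)) ⟩
    #subs (Q e) 1 (upTo n)
      ≡⟨ #subs-1 (Q e) (upTo n) ⟩
    ∑ (upTo n) (⟦_⟧ ∘ Q e)
      ≤⟨ no-subs⇒few (Q e) k (upTo n) (∑-zero∈ (subs k (upTo n)) λ {v} v∈ →
           ⟦⟧≡0 (boxFree-slice {A = A} free v∈ e∈ ∘ subst T (sym (full-slice e v A)))) ⟩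
    k ∎
boxFree⇒few-copies (k ∷ ks) (suc ℓ) n A free = begin
  copies (k ∷ ks′) A n * n
    ≡⟨ cong (_* n) (copies-∷ k ks′ A n) ⟩
  ∑ vs (λ v → copies ks′ (slice v A) n) * n
    ≡⟨ ∑-*ʳ vs n _ ⟨
  ∑ vs (λ v → copies ks′ (slice v A) n * n)
    ≤⟨ ∑-bound vs (λ {v} v∈ → boxFree⇒few-copies ks ℓ n (slice v A) (boxFree-slice {A = A} free v∈)) ⟩
  length vs * (lookup ks ℓ * n ^ sum ks′)
    ≤⟨ *-monoˡ-≤ (lookup ks ℓ * n ^ sum ks′) (length-subs-upTo k n) ⟩
  n ^ k * (lookup ks ℓ * n ^ sum ks′)
    ≡⟨ shuffle (n ^ k) (lookup ks ℓ) (n ^ sum ks′) ⟩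
  lookup ks ℓ * (n ^ k * n ^ sum ks′)
    ≡⟨ cong (lookup ks ℓ *_) (^-distribˡ-+-* n k (sum ks′)) ⟨
  lookup ks ℓ * n ^ (k + sum ks′) ∎
  where
  open ≤-Reasoning
  ks′ = ks [ ℓ ]≔ 1
  vs = subs k (upTo n)
  shuffle : ∀ x k y → x * (k * y) ≡ k * (x * y)
  shuffle = solve-∀

nonZero-[]≔1 : ∀ {d} {ks : Vec ℕ d} → All NonZero ks → ∀ ℓ → All NonZero (ks [ ℓ ]≔ 1)
nonZero-[]≔1 (p ∷ pos) zero    = _ ∷ pos
nonZero-[]≔1 (p ∷ pos) (suc ℓ) = p ∷ nonZero-[]≔1 pos ℓ

-- Kővári–Sós–Turán, at the side lengths n for which n ^ (1 / ∏_{i ≠ ℓ} kᵢ) is an integer z.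
boxFree⇒sparse : ∀ {d} (ks : Vec ℕ d) → All NonZero ks → ∀ ℓ z n .{{_ : NonZero n}} →
  z ^ product (ks [ ℓ ]≔ 1) ≡ n → (A : Vec ℕ d → Bool) → BoxFree ks n A →
  count A n * z ≤ (lookup ks ℓ + sum (ks [ ℓ ]≔ 1)) * n ^ d
boxFree⇒sparse {d} ks pos ℓ z n eq A free = *-cancelʳ-≤ _ _ W (begin
  count A n * z * W
    ≤⟨ supersaturation ks′ (nonZero-[]≔1 pos ℓ) z n eq A ⟩
  copies ks′ A n * n * n ^ d + sum ks′ * W * n ^ d
    ≤⟨ +-monoˡ-≤ _ (*-monoˡ-≤ (n ^ d) (boxFree⇒few-copies ks ℓ n A free)) ⟩
  lookup ks ℓ * W * n ^ d + sum ks′ * W * n ^ d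
    ≡⟨ gather (lookup ks ℓ) W (n ^ d) (sum ks′) ⟩
  (lookup ks ℓ + sum ks′) * n ^ d * W ∎)
  where
  open ≤-Reasoning
  ks′ = ks [ ℓ ]≔ 1
  W = n ^ sum ks′
  instance _ = m^n≢0 n (sum ks′)
  gather : ∀ a w N s → a * w * N + s * w * N ≡ (a + s) * N * w
  gather = solve-∀

-- Patterns whose ones are blown up to boxes, and rich blocks

lookup-box-∈ : ∀ {d} {ks : Vec ℕ d} {xs : List X} {e : Box X ks} → e ∈ boxes ks xs →
  ∀ ℓ → lookup⁺ e ℓ ∈ subs (lookup ks ℓ) xs
lookup-box-∈ {ks = k ∷ ks} {xs} e∈ ℓ with ∈-cartesianProductWith⁻ _∷_ (subs k xs) (boxes ks xs) e∈
lookup-box-∈ {ks = k ∷ ks} {xs} e∈ zero    | _ , _ , v∈ , e∈′ , refl = v∈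
lookup-box-∈ {ks = k ∷ ks} {xs} e∈ (suc ℓ) | _ , _ , v∈ , e∈′ , refl = lookup-box-∈ e∈′ ℓ

Increasing : ∀ {d} {ks : Vec ℕ d} → Box ℕ ks → Set
Increasing e = ∀ ℓ a b → a Fin.< b → lookup (lookup⁺ e ℓ) a < lookup (lookup⁺ e ℓ) b

box-increasing : ∀ {d n} {ks : Vec ℕ d} {e : Box ℕ ks} → e ∈ boxes ks (upTo n) → Increasing e
box-increasing {n = n} e∈ ℓ =
  sorted-lookup (subs-sorted _ (upTo n) (lookup-box-∈ e∈ ℓ) (upTo-sorted n))

box-bounded : ∀ {d n} {ks : Vec ℕ d} {e : Box ℕ ks} → e ∈ boxes ks (upTo n) →
  ∀ ℓ a → lookup (lookup⁺ e ℓ) a < n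
box-bounded {n = n} e∈ ℓ =
  VecAllₚ.lookup⁺ (subs-all _ (upTo n) (lookup-box-∈ e∈ ℓ) (upTo-bounded n))

-- Every i : I is replaced by a full box, as in the Kronecker product of the
-- pattern with R ks.

BoxOccurs : ∀ {d k} {I : Set} → (Fin d → I → Fin k) → Vec ℕ d → (Vec ℕ d → Bool) → Set
BoxOccurs {I = I} π ks A = ∃ λ (e : I → Box ℕ ks) →
  (∀ i → T (full (e i) A)) × (∀ i → Increasing (e i)) ×
  (∀ ℓ i j → π ℓ i Fin.< π ℓ j → ∀ a b → lookup (lookup⁺ (e i) ℓ) a < lookup (lookup⁺ (e j) ℓ) b)

shiftBox : ∀ {d} {ks : Vec ℕ d} → ℕ → Vec ℕ d → Box ℕ ks → Box ℕ ks
shiftBox n []      []      = []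
shiftBox n (b ∷ y) (v ∷ e) = Vec.map (b * n +_) v ∷ shiftBox n y e

lookup-shiftBox : ∀ {d} {ks : Vec ℕ d} n (b : Vec ℕ d) (e : Box ℕ ks) ℓ a →
  lookup (lookup⁺ (shiftBox n b e) ℓ) a ≡ lookup b ℓ * n + lookup (lookup⁺ e ℓ) a
lookup-shiftBox n (b ∷ y) (v ∷ e) zero    a = Vecₚ.lookup-map a (b * n +_) v
lookup-shiftBox n (b ∷ y) (v ∷ e) (suc ℓ) a = lookup-shiftBox n y e ℓ a

allᵛ-map : ∀ {k} (h : X → Y) (Q : Y → Bool) (v : Vec X k) → allᵛ Q (Vec.map h v) ≡ allᵛ (Q ∘ h) v
allᵛ-map h Q []      = refl
allᵛ-map h Q (x ∷ v) = cong (Q (h x) ∧_) (allᵛ-map h Q v)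

full-shiftBox : ∀ {d} {ks : Vec ℕ d} n (b : Vec ℕ d) (e : Box ℕ ks) A →
  full (shiftBox n b e) A ≡ full e (A ∘ inBlock n b)
full-shiftBox n []      []      A = refl
full-shiftBox n (b ∷ y) (v ∷ e) A =
  trans (full-shiftBox n y e _) (full-cong e λ x → allᵛ-map (b * n +_) _ v)

shift-increasing : ∀ {d} {ks : Vec ℕ d} n b {e : Box ℕ ks} → Increasing e → Increasing (shiftBox n b e)
shift-increasing n b {e} inc ℓ x y x<y =
  subst₂ _<_ (sym (lookup-shiftBox n b e ℓ x)) (sym (lookup-shiftBox n b e ℓ y))
    (+-monoʳ-< (lookup b ℓ * n) (inc ℓ x y x<y))

block-boxOccurs : ∀ {d k} {I : Set} (π : Fin d → I → Fin k) (ks : Vec ℕ d) n b A →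
  BoxOccurs π ks (A ∘ inBlock n b) → BoxOccurs π ks A
block-boxOccurs π ks n b A (e , e-full , e-inc , e<) =
  shiftBox n b ∘ e ,
  (λ i → subst T (sym (full-shiftBox n b (e i) A)) (e-full i)) ,
  (λ i → shift-increasing n b (e-inc i)) ,
  (λ ℓ i j lt x y → subst₂ _<_ (sym (lookup-shiftBox n b (e i) ℓ x)) (sym (lookup-shiftBox n b (e j) ℓ y))
    (+-monoʳ-< (lookup b ℓ * n) (e< ℓ i j lt x y)))

richBlock : ∀ {d} → Vec ℕ d → ℕ → (Vec ℕ d → Bool) → Vec ℕ d → Bool
richBlock ks n A b = any (λ e → full e (A ∘ inBlock n b)) (boxes ks (upTo n))

-- As for nonempty blocks, except that a whole box has to respect the order: `box-bounded` keeps it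
-- inside its block, so the order of two blocks passes to every pair of values.
richBlock-occurs : ∀ {d k m} {I : Set} (π : Fin d → I → Fin k) (ks : Vec ℕ d) n A →
  Occurs π m (richBlock ks n A) → BoxOccurs π ks A
richBlock-occurs {I = I} π ks n A (b , b∈ , b<) =
  (λ i → shiftBox n (b i) (e i)) ,
  (λ i → subst T (sym (full-shiftBox n (b i) (e i) A)) (proj₂ (proj₂ (box i)))) ,
  (λ i → shift-increasing n (b i) (box-increasing (proj₁ (proj₂ (box i))))) ,
  (λ ℓ i j lt x y → subst₂ _<_ (sym (lookup-shiftBox n (b i) (e i) ℓ x)) (sym (lookup-shiftBox n (b j) (e j) ℓ y))
    (block-< _ (b< ℓ i j lt) (box-bounded (proj₁ (proj₂ (box i))) ℓ x)))
  where
  box : ∀ i → ∃ λ e → e ∈ boxes ks (upTo n) × T (full e (A ∘ inBlock n (b i)))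
  box i = any-true _ (boxes ks (upTo n)) (proj₂ (b∈ i))
  e : I → Box ℕ ks
  e i = proj₁ (box i)

-- The factor `u` clears the denominator of the density bounds at side `n`.
count-rich-≤ : ∀ {d} (ks : Vec ℕ d) m n u rich poor A →
  (∀ b → count (A ∘ inBlock n b) n * u ≤ rich) →
  (∀ b → BoxFree ks n (A ∘ inBlock n b) → count (A ∘ inBlock n b) n * u ≤ poor) →
  count A (m * n) * u ≤ count (richBlock ks n A) m * rich + m ^ d * poor
count-rich-≤ {d} ks m n u rich poor A ≤rich ≤poor = begin
  count A (m * n) * u
    ≡⟨ cong (_* u) (∑-pts-blocks d m n _) ⟩
  ∑ (pts d m) (λ b → count (A ∘ inBlock n b) n) * u
    ≡⟨ ∑-*ʳ (pts d m) u _ ⟨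
  ∑ (pts d m) (λ b → count (A ∘ inBlock n b) n * u)
    ≤⟨ ∑-mono (pts d m) per-block ⟩
  ∑ (pts d m) (λ b → ⟦ richBlock ks n A b ⟧ * rich + poor)
    ≡⟨ trans (∑-+ (pts d m) _ _) (cong₂ _+_ (∑-*ʳ (pts d m) rich _) (∑-const (pts d m) poor)) ⟩
  count (richBlock ks n A) m * rich + length (pts d m) * poor
    ≡⟨ cong (λ t → count (richBlock ks n A) m * rich + t * poor) (length-pts d m) ⟩
  count (richBlock ks n A) m * rich + m ^ d * poor ∎
  where
  open ≤-Reasoning
  per-block : ∀ b → count (A ∘ inBlock n b) n * u ≤ ⟦ richBlock ks n A b ⟧ * rich + poor
  per-block b with richBlock ks n A b in eq
  ... | true  = ≤-trans (≤rich b) (≤-trans (≤-reflexive (sym (*-identityˡ rich))) (m≤m+n (1 * rich) poor))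
  ... | false = ≤poor b λ e∈ t → subst T eq (any-intro _ e∈ t)

-- Choice of the block side and the recursion for the upper bound

count-mono : ∀ {d n n′} (A : Vec ℕ d → Bool) → n ≤ n′ → count A n ≤ count A n′
count-mono {d} A n≤n′ = ∑-pts-mono d _ n≤n′
  where
  ∑-upTo-mono : ∀ {n n′} (g : ℕ → ℕ) → n ≤ n′ → ∑ (upTo n) g ≤ ∑ (upTo n′) g
  ∑-upTo-mono {n} {n′} g n≤n′ = begin
    ∑ (upTo n) g                                       ≤⟨ m≤m+n _ (∑ (upTo (n′ ∸ n)) (g ∘ (n +_))) ⟩
    ∑ (upTo n) g + ∑ (upTo (n′ ∸ n)) (g ∘ (n +_))      ≡⟨ ∑-upTo-+ n (n′ ∸ n) g ⟨
    ∑ (upTo (n + (n′ ∸ n))) g                          ≡⟨ cong (λ t → ∑ (upTo t) g) (m+[n∸m]≡n n≤n′) ⟩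
    ∑ (upTo n′) g                                      ∎
    where open ≤-Reasoning
  ∑-pts-mono : ∀ d {n n′} (g : Vec ℕ d → ℕ) → n ≤ n′ → ∑ (pts d n) g ≤ ∑ (pts d n′) g
  ∑-pts-mono zero    g n≤n′ = ≤-refl
  ∑-pts-mono (suc d) {n} {n′} g n≤n′ = begin
    ∑ (pts (suc d) n) g                              ≡⟨ ∑-pts-suc d n g ⟩
    ∑ (upTo n) (λ x → ∑ (pts d n) (g ∘ (x ∷_)))      ≤⟨ ∑-mono (upTo n) (λ x → ∑-pts-mono d _ n≤n′) ⟩
    ∑ (upTo n) (λ x → ∑ (pts d n′) (g ∘ (x ∷_)))     ≤⟨ ∑-upTo-mono _ n≤n′ ⟩
    ∑ (upTo n′) (λ x → ∑ (pts d n′) (g ∘ (x ∷_)))    ≡⟨ ∑-pts-suc d n′ g ⟨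
    ∑ (pts (suc d) n′) g                             ∎
    where open ≤-Reasoning

n≤2^n : ∀ n → n ≤ 2 ^ n
n≤2^n zero    = z≤n
n≤2^n (suc n) = begin
  suc n             ≤⟨ +-mono-≤ (m^n>0 2 n) (n≤2^n n) ⟩
  2 ^ n + 2 ^ n     ≡⟨ cong (2 ^ n +_) (+-identityʳ (2 ^ n)) ⟨
  2 ^ suc n         ∎
  where open ≤-Reasoning

m≤m^n : ∀ m n .{{_ : NonZero m}} .{{_ : NonZero n}} → m ≤ m ^ n
m≤m^n m (suc n) = m≤m*n m (m ^ n) {{m^n≢0 m n}}

-- `avoid-pattern` loses a constant `c` and a factor `K` per level. Both are covered by w = (2 K) ^
-- j, where `2 ^ j` dominates 2 c. Then 2 w times the density is at most w ^ 2 / m, and `E` ≥ 2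
-- makes this at most 1.
sparse-scale : ∀ k d E → 2 ≤ E → ∃ λ w → 2 ≤ w × (∀ {I : Set} (π : Fin d → I → Fin (suc k)) B →
  ¬ Occurs π (w ^ E) B → 2 * w * count B (w ^ E) ≤ (w ^ E) ^ d)
sparse-scale k d E 2≤E = w , 2≤w , bound
  where
  K = suc (suc k)
  s = (2 * K) ^ E
  c = patternConst k s d
  -- The constant `c` depends on `s` but not on `j`, so `j` can be chosen after it.
  j = suc c
  w = (2 * K) ^ j
  m = w ^ E
  2≤w : 2 ≤ w
  2≤w = ≤-trans (m≤m*n 2 K) (m≤m^n (2 * K) j)
  instance
    _ = m^n≢0 (2 * K) j
    _ = m^n≢0 w E
  s^j≡m : s ^ j ≡ m
  s^j≡m = ^-swap (2 * K) E j
  2c≤2^j : 2 * c ≤ 2 ^ j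
  2c≤2^j = *-monoʳ-≤ 2 (n≤2^n c)
  bound : ∀ {I : Set} (π : Fin d → I → Fin (suc k)) B → ¬ Occurs π m B → 2 * w * count B m ≤ m ^ d
  bound π B ¬occ = *-cancelʳ-≤ _ _ m (begin
    2 * w * count B m * m              ≡⟨ e₁ w (count B m) m ⟩
    2 * w * (m * count B m)            ≡⟨ cong (λ t → 2 * w * (t * count B t)) s^j≡m ⟨
    2 * w * (s ^ j * count B (s ^ j))  ≤⟨ *-monoʳ-≤ (2 * w) (avoid-pattern k s π j B
                                            (¬occ ∘ subst (λ t → Occurs π t B) s^j≡m)) ⟩
    2 * w * (c * (K * s ^ d) ^ j)      ≡⟨ cong (λ t → 2 * w * (c * t)) (trans (^-distribʳ-* j K (s ^ d))
                                            (cong (K ^ j *_) s^d^j)) ⟩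
    2 * w * (c * (K ^ j * m ^ d))      ≡⟨ e₂ w c (K ^ j) (m ^ d) ⟩
    2 * c * K ^ j * (w * m ^ d)        ≤⟨ *-monoˡ-≤ (w * m ^ d) (*-monoˡ-≤ (K ^ j) 2c≤2^j) ⟩
    2 ^ j * K ^ j * (w * m ^ d)        ≡⟨ cong (_* (w * m ^ d)) (^-distribʳ-* j 2 K) ⟨
    w * (w * m ^ d)                    ≡⟨ e₃ w (m ^ d) ⟩
    m ^ d * w ^ 2                      ≤⟨ *-monoʳ-≤ (m ^ d) (^-monoʳ-≤ w 2≤E) ⟩
    m ^ d * m                          ∎)
    where
    open ≤-Reasoning
    s^d^j : (s ^ d) ^ j ≡ m ^ d
    s^d^j = trans (^-swap s d j) (cong (_^ d) s^j≡m)
    e₁ : ∀ w x m → 2 * w * x * m ≡ 2 * w * (m * x)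
    e₁ = solve-∀
    e₂ : ∀ w c x y → 2 * w * (c * (x * y)) ≡ 2 * c * x * (w * y)
    e₂ = solve-∀
    e₃ : ∀ w y → w * (w * y) ≡ y * (w * (w * 1))
    e₃ = solve-∀

-- Each step multiplies the side by m and the saving by w. At most m ^ d / (2 w) blocks are rich,
-- and the bound for the smaller side makes them contribute half of the target. The other blocks
-- contribute at most the other half, as `C` exceeds 2 w times the constant of `boxFree⇒sparse`.
boxOccurs-free : ∀ {d k} {I : Set} (π : Fin d → I → Fin k) (ks : Vec ℕ d) → All NonZero ks → ∀ ℓ w →
  let E = product (ks [ ℓ ]≔ 1)
      m = w ^ E
      C = suc (2 * w * (lookup ks ℓ + sum (ks [ ℓ ]≔ 1))) in
  .{{_ : NonZero m}} →
  (∀ B → ¬ Occurs π m B → 2 * w * count B m ≤ m ^ d) →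
  ∀ j A → ¬ BoxOccurs π ks A → count A (m ^ j) * w ^ j ≤ C * (m ^ j) ^ d
boxOccurs-free {d} π ks pos ℓ w sparse zero    A ¬occ = begin
  count A 1 * 1                ≤⟨ *-monoˡ-≤ 1 (∑-bound (pts d 1) λ {y} _ → ⟦⟧≤1 (A y)) ⟩
  length (pts d 1) * 1 * 1     ≡⟨ cong (λ t → t * 1 * 1) (length-pts d 1) ⟩
  1 ^ d * 1 * 1                ≡⟨ trans (*-identityʳ _) (trans (*-identityʳ _) (sym (*-identityˡ (1 ^ d)))) ⟩
  1 * 1 ^ d                    ≤⟨ *-monoˡ-≤ (1 ^ d) (s≤s (z≤n {C})) ⟩
  suc C * 1 ^ d                ∎
  where
  open ≤-Reasoning
  C = 2 * w * (lookup ks ℓ + sum (ks [ ℓ ]≔ 1))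
boxOccurs-free {d} π ks pos ℓ w sparse (suc j) A ¬occ = *-cancelˡ-≤ 2 (begin
  2 * (count A (m * n) * (w * w ^ j))
    ≡⟨ e₁ (count A (m * n)) w (w ^ j) ⟩
  2 * w * (count A (m * n) * w ^ j)
    ≤⟨ *-monoʳ-≤ (2 * w) (count-rich-≤ ks m n (w ^ j) (C * n ^ d) (c * n ^ d) A
         (λ b → boxOccurs-free π ks pos ℓ w sparse j (A ∘ inBlock n b) (¬occ ∘ block-boxOccurs π ks n b A))
         (λ b → boxFree⇒sparse ks pos ℓ (w ^ j) n (^-swap w j (product (ks [ ℓ ]≔ 1))) (A ∘ inBlock n b))) ⟩
  2 * w * (count B m * (C * n ^ d) + m ^ d * (c * n ^ d))
    ≡⟨ e₂ w (count B m) (C * n ^ d) (m ^ d) c (n ^ d) ⟩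
  2 * w * count B m * (C * n ^ d) + 2 * w * c * (m ^ d * n ^ d)
    ≤⟨ +-mono-≤ (*-monoˡ-≤ (C * n ^ d) (sparse B (¬occ ∘ richBlock-occurs π ks n A)))
                (*-monoˡ-≤ (m ^ d * n ^ d) (n≤1+n (2 * w * c))) ⟩
  m ^ d * (C * n ^ d) + C * (m ^ d * n ^ d)
    ≡⟨ e₃ (m ^ d) C (n ^ d) ⟩
  2 * (C * (m ^ d * n ^ d))
    ≡⟨ cong (λ t → 2 * (C * t)) (^-distribʳ-* d m n) ⟨
  2 * (C * (m * n) ^ d) ∎)
  where
  open ≤-Reasoning
  m = w ^ product (ks [ ℓ ]≔ 1)
  n = m ^ j
  instance _ = m^n≢0 m j
  c = lookup ks ℓ + sum (ks [ ℓ ]≔ 1)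
  C = suc (2 * w * c)
  B = richBlock ks n A
  e₁ : ∀ x w u → 2 * (x * (w * u)) ≡ 2 * w * (x * u)
  e₁ = solve-∀
  e₂ : ∀ w x y m c n → 2 * w * (x * y + m * (c * n)) ≡ 2 * w * x * y + 2 * w * c * (m * n)
  e₂ = solve-∀
  e₃ : ∀ m C n → m * (C * n) + C * (m * n) ≡ 2 * (C * (m * n))
  e₃ = solve-∀

power-above : ∀ m → 2 ≤ m → ∀ n .{{_ : NonZero n}} → ∃ λ j → n ≤ m ^ j × m ^ j ≤ m * n
power-above m 2≤m (suc zero) = 0 , ≤-refl , ≤-trans (<⇒≤ 2≤m) (≤-reflexive (sym (*-identityʳ m)))
power-above m 2≤m (suc (suc n)) with power-above m 2≤m (suc n)
... | j , lo , hi with m≤n⇒m<n∨m≡n lo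
... | inj₁ lt = j , lt , ≤-trans hi (*-monoʳ-≤ m (n≤1+n (suc n)))
... | inj₂ eq = suc j ,
  (begin
    1 + suc n        ≤⟨ +-monoˡ-≤ (suc n) (s≤s z≤n) ⟩
    suc n + suc n    ≡⟨ cong (suc n +_) (+-identityʳ (suc n)) ⟨
    2 * suc n        ≤⟨ *-monoˡ-≤ (suc n) 2≤m ⟩
    m * suc n        ≡⟨ cong (m *_) eq ⟩
    m * m ^ j        ∎) ,
  (begin
    m * m ^ j        ≡⟨ cong (m *_) eq ⟨
    m * suc n        ≤⟨ *-monoʳ-≤ m (n≤1+n (suc n)) ⟩
    m * suc (suc n)  ∎)
  where open ≤-Reasoning

-- The bound C n ^ (d - 1 / E), raised to the power E. Rounding n up to a power of m costs the
-- factor `m ^ d`, and the constant is fixed before the pattern and n.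
boxOccurs-upper : ∀ {d} k (ks : Vec ℕ d) → All NonZero ks → ∀ ℓ → 2 ≤ product (ks [ ℓ ]≔ 1) →
  ∃ λ C → ∀ {I : Set} (π : Fin d → I → Fin (suc k)) n .{{_ : NonZero n}} A → ¬ BoxOccurs π ks A →
  count A n ^ product (ks [ ℓ ]≔ 1) * n ≤ (suc C * n ^ d) ^ product (ks [ ℓ ]≔ 1)
boxOccurs-upper {d} k ks pos ℓ 2≤E = C₀ * m ^ d , bound
  where
  E = product (ks [ ℓ ]≔ 1)
  scale = sparse-scale k d E 2≤E
  w = proj₁ scale
  m = w ^ E
  C₀ = suc (2 * w * (lookup ks ℓ + sum (ks [ ℓ ]≔ 1)))
  instance
    _ : NonZero w
    _ = ℕ.>-nonZero (<⇒≤ (proj₁ (proj₂ scale)))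
    _ : NonZero E
    _ = ℕ.>-nonZero (<⇒≤ 2≤E)
    _ : NonZero m
    _ = m^n≢0 w E
  2≤m : 2 ≤ m
  2≤m = ≤-trans (proj₁ (proj₂ scale)) (m≤m^n w E)
  bound : ∀ {I : Set} (π : Fin d → I → Fin (suc k)) n .{{_ : NonZero n}} A → ¬ BoxOccurs π ks A →
          count A n ^ E * n ≤ (suc (C₀ * m ^ d) * n ^ d) ^ E
  bound π n A ¬occ with power-above m 2≤m n
  ... | j , n≤ , ≤mn = begin
    count A n ^ E * n                ≤⟨ *-mono-≤ (^-monoˡ-≤ E (count-mono A n≤)) n≤ ⟩
    count A (m ^ j) ^ E * m ^ j      ≡⟨ cong (count A (m ^ j) ^ E *_) (^-swap w j E) ⟨
    count A (m ^ j) ^ E * (w ^ j) ^ E ≡⟨ ^-distribʳ-* E (count A (m ^ j)) (w ^ j) ⟨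
    (count A (m ^ j) * w ^ j) ^ E    ≤⟨ ^-monoˡ-≤ E (boxOccurs-free π ks pos ℓ w (proj₂ (proj₂ scale) π) j A ¬occ) ⟩
    (C₀ * (m ^ j) ^ d) ^ E           ≤⟨ ^-monoˡ-≤ E (*-monoʳ-≤ C₀ (^-monoˡ-≤ d ≤mn)) ⟩
    (C₀ * (m * n) ^ d) ^ E           ≡⟨ cong (_^ E) (trans (cong (C₀ *_) (^-distribʳ-* d m n))
                                          (sym (*-assoc C₀ (m ^ d) (n ^ d)))) ⟩
    (C₀ * m ^ d * n ^ d) ^ E         ≤⟨ ^-monoˡ-≤ E (*-monoˡ-≤ (n ^ d) (n≤1+n (C₀ * m ^ d))) ⟩
    (suc (C₀ * m ^ d) * n ^ d) ^ E   ∎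
    where open ≤-Reasoning

-- From finite index types to predicates; containment of the Kronecker product

toℕs : ∀ {d} {ns : Vec ℕ d} → Index ns → Vec ℕ d
toℕs []       = []
toℕs (i ∷ is) = toℕ i ∷ toℕs is

toℕs-injective : ∀ {d} {ns : Vec ℕ d} (i j : Index ns) → toℕs i ≡ toℕs j → i ≡ j
toℕs-injective []       []       eq = refl
toℕs-injective (i ∷ is) (j ∷ js) eq =
  cong₂ _∷_ (Finₚ.toℕ-injective (Vecₚ.∷-injectiveˡ eq)) (toℕs-injective is js (Vecₚ.∷-injectiveʳ eq))

-- The result of `lookup⁺` has a type that equals `Fin k` only up to a transport; recursion on `d`
-- avoids it.
coord : ∀ d {k} → Index (cube d k) → Fin d → Fin k
coord (suc d) (i ∷ is) zero    = i
coord (suc d) (i ∷ is) (suc ℓ) = coord d is ℓ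

lookup-toℕs : ∀ d {n} (i : Index (cube d n)) ℓ → lookup (toℕs i) ℓ ≡ toℕ (coord d i ℓ)
lookup-toℕs (suc d) (i ∷ is) zero    = refl
lookup-toℕs (suc d) (i ∷ is) (suc ℓ) = lookup-toℕs d is ℓ

coord-lookup⁺ : ∀ d {k} (i : Index (cube d k)) ℓ →
  coord d i ℓ ≡ subst Fin (Vecₚ.lookup-replicate ℓ k) (lookup⁺ i ℓ)
coord-lookup⁺ (suc d) (i ∷ is) zero    = refl
coord-lookup⁺ (suc d) (i ∷ is) (suc ℓ) = coord-lookup⁺ d is ℓ

theOne : ∀ d {k} {P : Matrix (cube d k)} → IsPermutation P → ∀ ℓ (p : Fin k) →
  ∃ λ o → P o ≡ true × coord d o ℓ ≡ p × (∀ {i} → P i ≡ true → coord d i ℓ ≡ p → o ≡ i)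
theOne d {k} {P} perm ℓ p with perm ℓ (subst Fin (sym (Vecₚ.lookup-replicate ℓ k)) p)
... | o , (o≡ , Po) , unique = o , Po ,
  trans (coord-lookup⁺ d o ℓ) (trans (cong (subst Fin (Vecₚ.lookup-replicate ℓ k)) o≡) (subst-subst-sym (Vecₚ.lookup-replicate ℓ k))) ,
  λ {i} Pi i≡ → unique (trans (sym (subst-sym-subst (Vecₚ.lookup-replicate ℓ k)))
    (cong (subst Fin (sym (Vecₚ.lookup-replicate ℓ k))) (trans (sym (coord-lookup⁺ d i ℓ)) i≡)) , Pi)

∈-allIndices : ∀ {d} {ns : Vec ℕ d} (i : Index ns) → i ∈ allIndices ns
∈-allIndices []       = here refl
∈-allIndices (i ∷ is) = ∈-cartesianProductWith⁺ _∷_ (∈-allFin i) (∈-allIndices is)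

extend : ∀ {d} {ns : Vec ℕ d} → Matrix ns → Vec ℕ d → Bool
extend {ns = ns} A y = any (λ i → A i ∧ ⌊ Vecₚ.≡-dec ℕ._≟_ (toℕs i) y ⌋) (allIndices ns)

extend-toℕs : ∀ {d} {ns : Vec ℕ d} (A : Matrix ns) i → T (A i) → T (extend A (toℕs i))
extend-toℕs A i Ai = any-intro _ (∈-allIndices i) (Equivalence.from T-∧ (Ai , fromWitness refl))

extend⁻ : ∀ {d} {ns : Vec ℕ d} (A : Matrix ns) y → T (extend A y) → ∃ λ i → T (A i) × toℕs i ≡ y
extend⁻ {ns = ns} A y t with any-true _ (allIndices ns) t
... | i , _ , t′ = i , proj₁ (Equivalence.to T-∧ t′) , toWitness (proj₂ (Equivalence.to (T-∧ {x = A i}) t′))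

length-filterᵇ : (p : X → Bool) (xs : List X) → length (filterᵇ p xs) ≡ ∑ xs (⟦_⟧ ∘ p)
length-filterᵇ p []       = refl
length-filterᵇ p (x ∷ xs) with p x
... | true  = cong suc (length-filterᵇ p xs)
... | false = length-filterᵇ p xs

tabulate-toℕ : ∀ n (h : ℕ → ℕ) → Data.List.tabulate {n = n} (h ∘ toℕ) ≡ applyUpTo h n
tabulate-toℕ zero    h = refl
tabulate-toℕ (suc n) h = cong (h 0 ∷_) (tabulate-toℕ n (h ∘ suc))

∑-allFin : ∀ n (g : ℕ → ℕ) → ∑ (allFin n) (g ∘ toℕ) ≡ ∑ (upTo n) g
∑-allFin n g = cong sumᴸ (trans (Listₚ.map-tabulate id (g ∘ toℕ)) (trans (tabulate-toℕ n g) (sym (Listₚ.map-upTo g n))))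

∑-allIndices : ∀ d n (g : Vec ℕ d → ℕ) → ∑ (allIndices (cube d n)) (g ∘ toℕs) ≡ ∑ (pts d n) g
∑-allIndices zero    n g = refl
∑-allIndices (suc d) n g = begin
  ∑ (allIndices (cube (suc d) n)) (g ∘ toℕs)
    ≡⟨ ∑-cartesian _∷_ (allFin n) (allIndices (cube d n)) _ ⟩
  ∑ (allFin n) (λ i → ∑ (allIndices (cube d n)) (λ is → g (toℕ i ∷ toℕs is)))
    ≡⟨ ∑-cong (allFin n) (λ i → ∑-allIndices d n _) ⟩
  ∑ (allFin n) (λ i → ∑ (pts d n) (λ y → g (toℕ i ∷ y)))
    ≡⟨ ∑-allFin n (λ x → ∑ (pts d n) (λ y → g (x ∷ y))) ⟩
  ∑ (upTo n) (λ x → ∑ (pts d n) (λ y → g (x ∷ y)))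
    ≡⟨ ∑-pts-suc d n g ⟨
  ∑ (pts (suc d) n) g ∎
  where open ≡-Reasoning

ones≤count-extend : ∀ d n (A : Matrix (cube d n)) → ones A ≤ count (extend A) n
ones≤count-extend d n A = begin
  ones A                                                  ≡⟨ length-filterᵇ A (allIndices (cube d n)) ⟩
  ∑ (allIndices (cube d n)) (⟦_⟧ ∘ A)                     ≤⟨ ∑-mono (allIndices (cube d n)) (λ i → ⟦⟧-mono (extend-toℕs A i)) ⟩
  ∑ (allIndices (cube d n)) (⟦_⟧ ∘ extend A ∘ toℕs)       ≡⟨ ∑-allIndices d n _ ⟩
  count (extend A) n                                      ∎
  where open ≤-Reasoning

pick : ∀ {d} {ks : Vec ℕ d} → Box ℕ ks → Index ks → Vec ℕ d
pick []      []       = []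
pick (v ∷ e) (i ∷ is) = lookup v i ∷ pick e is

lookup-pick : ∀ {d} {ks : Vec ℕ d} (e : Box ℕ ks) is ℓ →
  lookup (pick e is) ℓ ≡ lookup (lookup⁺ e ℓ) (lookup⁺ is ℓ)
lookup-pick (v ∷ e) (i ∷ is) zero    = refl
lookup-pick (v ∷ e) (i ∷ is) (suc ℓ) = lookup-pick e is ℓ

full-pick : ∀ {d} {ks : Vec ℕ d} (e : Box ℕ ks) A → T (full e A) → ∀ is → T (A (pick e is))
full-pick []      A t []       = t
full-pick (v ∷ e) A t (i ∷ is) = allᵛ-lookup _ v (full-pick e (slice v A) t is) i

zeroIndex : ∀ {d} {ks : Vec ℕ d} → All NonZero ks → Index ks
zeroIndex []                     = []
zeroIndex (_∷_ {x = suc k} p pos) = zero ∷ zeroIndex pos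

indexThrough : ∀ {d} {ks : Vec ℕ d} → All NonZero ks → ∀ ℓ (a : Fin (lookup ks ℓ)) →
  ∃ λ (is : Index ks) → lookup⁺ is ℓ ≡ a
indexThrough (p ∷ pos)                 zero    a = a ∷ zeroIndex pos , refl
indexThrough (_∷_ {x = suc k} p pos)   (suc ℓ) a =
  let is , eq = indexThrough pos ℓ a in zero ∷ is , eq

-- Every value used by the box is a coordinate of one of its points, and that point is a one of `A`.
-- Such a point exists because no side is 0: an empty box would be full whatever its other values
-- are.
full-extend-bounded : ∀ d {n} {ks : Vec ℕ d} → All NonZero ks → (A : Matrix (cube d n)) (e : Box ℕ ks) →
  T (full e (extend A)) → ∀ ℓ a → lookup (lookup⁺ e ℓ) a < n
full-extend-bounded d {n} pos A e t ℓ a =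
  let is , is≡    = indexThrough pos ℓ a
      i , _ , i≡ = extend⁻ A (pick e is) (full-pick e (extend A) t is)
  in  subst (_< n)
        (trans (sym (lookup-toℕs d i ℓ)) (trans (cong (λ y → lookup y ℓ) i≡)
          (trans (lookup-pick e is ℓ) (cong (lookup (lookup⁺ e ℓ)) is≡))))
        (Finₚ.toℕ<n (coord d i ℓ))

LexLess : ∀ {m n} → Fin m × Fin n → Fin m × Fin n → Set
LexLess (p , q) (p′ , q′) = p Fin.< p′ ⊎ (p ≡ p′ × q Fin.< q′)

remQuot-lex : ∀ {m} n {i j : Fin (m * n)} → i Fin.< j → LexLess (remQuot {m} n i) (remQuot {m} n j)
remQuot-lex {m} n {i} {j} i<j = compare (subst₂ Fin._<_ (sym (Finₚ.combine-remQuot {m} n i)) (sym (Finₚ.combine-remQuot {m} n j)) i<j)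
  where
  compare : ∀ {p p′ : Fin m} {q q′ : Fin n} → combine p q Fin.< combine p′ q′ → LexLess (p , q) (p′ , q′)
  compare {p} {p′} {q} {q′} lt with Finₚ.<-cmp p p′
  ... | tri< p<p′ _ _  = inj₁ p<p′
  ... | tri≈ _ refl _  = inj₂ (refl , +-cancelˡ-< (n * toℕ p) _ _
    (subst₂ _<_ (Finₚ.toℕ-combine p q) (Finₚ.toℕ-combine p q′) lt))
  ... | tri> _ _ p′<p  = contradiction (<-trans lt (Finₚ.combine-monoˡ-< q′ q p′<p)) (<-irrefl refl)

tabulate-sorted : ∀ {m n} {h : Fin m → Fin n} → (∀ {i j} → i Fin.< j → h i Fin.< h j) →
  AllPairs Fin._<_ (tabulate h)
tabulate-sorted {zero}  mono = []
tabulate-sorted {suc m} mono = VecAllₚ.tabulate⁺ (λ i → mono (s≤s z≤n)) ∷ tabulate-sorted (mono ∘ s≤s)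

LexMonotone : ∀ {k m n} → (Fin k → Fin m → Fin n) → Set
LexMonotone h = ∀ p q p′ q′ → LexLess (p , q) (p′ , q′) → h p q Fin.< h p′ q′

blockSelection : ∀ {d k n} (ks : Vec ℕ d) (h : ∀ ℓ → Fin k → Fin (lookup ks ℓ) → Fin n) →
  (∀ ℓ → LexMonotone (h ℓ)) → Selection (zipWith _*_ (cube d k) ks) (cube d n)
blockSelection         []       h mono = []
blockSelection {k = k} (m ∷ ks) h mono =
  (tabulate (λ i → h zero (proj₁ (remQuot {k} m i)) (proj₂ (remQuot {k} m i))) ,
   tabulate-sorted (λ i<j → mono zero _ _ _ _ (remQuot-lex {k} m i<j)))
  ∷ blockSelection ks (h ∘ suc) (mono ∘ suc)

select-blockSelection : ∀ {d k n} (ks : Vec ℕ d) (h : ∀ ℓ → Fin k → Fin (lookup ks ℓ) → Fin n) mono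
  (e : Box ℕ ks) i →
  (∀ ℓ → let p , q = blockIndex (cube d k) ks i in
    toℕ (h ℓ (coord d p ℓ) (lookup⁺ q ℓ)) ≡ lookup (lookup⁺ e ℓ) (lookup⁺ q ℓ)) →
  toℕs (select (blockSelection ks h mono) i) ≡ pick e (proj₂ (blockIndex (cube d k) ks i))
select-blockSelection []       h mono []      []       eq = refl
select-blockSelection {k = k} (m ∷ ks) h mono (v ∷ e) (i ∷ is) eq =
  cong₂ _∷_ (trans (cong toℕ (Vecₚ.lookup∘tabulate _ i)) (eq zero))
            (select-blockSelection ks (h ∘ suc) (mono ∘ suc) e is (eq ∘ suc))

-- The pattern has an element for every index of the cube, not just for the ones of `P`; elements
-- sharing a coordinate are not compared in it, so the pattern bounds cover this case. In direction
-- `ℓ` the rows for position `p` are read off the box at the one of `P` whose `ℓ`-th coordinate is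
-- `p`.
boxOccurs⇒contains : ∀ d {k n} {P : Matrix (cube d k)} → IsPermutation P →
  (ks : Vec ℕ d) → All NonZero ks → (A : Matrix (cube d n)) →
  BoxOccurs (λ ℓ i → coord d i ℓ) ks (extend A) → Contains A (P ⊗ R ks)
boxOccurs⇒contains d {k} {n} {P} perm ks pos A (e , e-full , e-inc , e<) = σ , entrywise
  where
  o : ∀ ℓ → Fin k → Index (cube d k)
  o ℓ p = proj₁ (theOne d perm ℓ p)
  coord-o : ∀ ℓ p → coord d (o ℓ p) ℓ ≡ p
  coord-o ℓ p = proj₁ (proj₂ (proj₂ (theOne d perm ℓ p)))
  value : ∀ ℓ → Fin k → Fin (lookup ks ℓ) → ℕ
  value ℓ p q = lookup (lookup⁺ (e (o ℓ p)) ℓ) q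
  value< : ∀ ℓ p q → value ℓ p q < n
  value< ℓ p q = full-extend-bounded d pos A (e (o ℓ p)) (e-full (o ℓ p)) ℓ q
  h : ∀ ℓ → Fin k → Fin (lookup ks ℓ) → Fin n
  h ℓ p q = fromℕ< (value< ℓ p q)
  mono : ∀ ℓ → LexMonotone (h ℓ)
  mono ℓ p q p′ q′ lex = subst₂ _<_ (sym (Finₚ.toℕ-fromℕ< (value< ℓ p q))) (sym (Finₚ.toℕ-fromℕ< (value< ℓ p′ q′))) (value-mono lex)
    where
    value-mono : LexLess (p , q) (p′ , q′) → value ℓ p q < value ℓ p′ q′
    value-mono (inj₁ p<p′)          = e< ℓ (o ℓ p) (o ℓ p′) (subst₂ Fin._<_ (sym (coord-o ℓ p)) (sym (coord-o ℓ p′)) p<p′) q q′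
    value-mono (inj₂ (refl , q<q′)) = e-inc (o ℓ p) ℓ q q′ q<q′
  σ : Selection (zipWith _*_ (cube d k) ks) (cube d n)
  σ = blockSelection ks h mono
  entrywise : ∀ i → (P ⊗ R ks) i Bool.≤ submatrix A σ i
  entrywise i with P (proj₁ (blockIndex (cube d k) ks i)) in Pp
  ... | false = Boolₚ.≤-minimum _
  ... | true  = subst (true Bool.≤_) (sym (Equivalence.to T-≡ (subst (T ∘ A) j≡ Aj))) Bool.b≤b
    where
    p = proj₁ (blockIndex (cube d k) ks i)
    q = proj₂ (blockIndex (cube d k) ks i)
    -- At a one of `P` the choices made in the separate directions all lead back to `p`, so the
    -- selected entry lies in the single box `e p`.
    o≡p : ∀ ℓ → o ℓ (coord d p ℓ) ≡ p
    o≡p ℓ = proj₂ (proj₂ (proj₂ (theOne d perm ℓ (coord d p ℓ)))) Pp refl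
    selected : toℕs (select σ i) ≡ pick (e p) q
    selected = select-blockSelection ks h mono (e p) i λ ℓ →
      trans (Finₚ.toℕ-fromℕ< (value< ℓ (coord d p ℓ) (lookup⁺ q ℓ)))
            (cong (λ x → lookup (lookup⁺ (e x) ℓ) (lookup⁺ q ℓ)) (o≡p ℓ))
    source = extend⁻ A (pick (e p) q) (full-pick (e p) (extend A) (e-full p) q)
    Aj = proj₁ (proj₂ source)
    j≡ : proj₁ source ≡ select σ i
    j≡ = toℕs-injective _ _ (trans (proj₂ (proj₂ source)) (sym selected))

-- The deletion method by conditional expectations

∏ : List X → (X → ℕ) → ℕ
∏ xs g = productᴸ (map g xs)

-- The difference g - h is the average of g₁ - h₁ and g₀ - h₀ with weights 1 and r, so one of these
-- is at least g - h. Terms are moved across to avoid subtraction.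
mixture-choice : ∀ r g h g₀ h₀ g₁ h₁ → suc r * g ≡ g₁ + r * g₀ → suc r * h ≡ h₁ + r * h₀ →
  g + h₁ ≤ h + g₁ ⊎ g + h₀ ≤ h + g₀
mixture-choice r g h g₀ h₀ g₁ h₁ eg eh with ≤-<-connex (g + h₁) (h + g₁) | ≤-<-connex (g + h₀) (h + g₀)
... | inj₁ le | _       = inj₁ le
... | inj₂ _  | inj₁ le = inj₂ le
... | inj₂ gt | inj₂ gt′ = contradiction impossible (<-irrefl refl)
  where
  open ≤-Reasoning
  expand : ∀ g h r x y → g + x + r * (g + y) ≡ suc r * g + (x + r * y)
  expand = solve-∀
  impossible : suc r * g + suc r * h < suc r * g + suc r * h
  impossible = begin-strict
    suc r * g + suc r * h            ≡⟨ +-comm (suc r * g) _ ⟩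
    suc r * h + suc r * g            ≡⟨ cong (suc r * h +_) eg ⟩
    suc r * h + (g₁ + r * g₀)        ≡⟨ expand h g r g₁ g₀ ⟨
    h + g₁ + r * (h + g₀)            <⟨ +-mono-<-≤ gt (*-monoʳ-≤ r (<⇒≤ gt′)) ⟩
    g + h₁ + r * (g + h₀)            ≡⟨ expand g h r h₁ h₀ ⟩
    suc r * g + (h₁ + r * h₀)        ≡⟨ cong (suc r * g +_) eh ⟨
    suc r * g + suc r * h            ∎

-- Deletion method for a hypergraph with vertices xs and edges es, all of size
-- suc κ, where a vertex is selected with probability 1 / suc r.  The random set
-- is produced by conditional expectations: a weight p x is 1 while x is
-- undecided, and then 0 or suc r.

module Deletion (_≟_ : DecidableEquality X) (r : ℕ) where

  q : ℕ
  q = suc r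

  update : (X → ℕ) → X → ℕ → X → ℕ
  update p u t x with x ≟ u
  ... | yes _ = t
  ... | no  _ = p x

  update-≡ : ∀ p u t → update p u t u ≡ t
  update-≡ p u t with u ≟ u
  ... | yes _   = refl
  ... | no  u≢u = contradiction refl u≢u

  update-≢ : ∀ p u t {x} → x ≢ u → update p u t x ≡ p x
  update-≢ p u t {x} x≢u with x ≟ u
  ... | yes x≡u = contradiction x≡u x≢u
  ... | no  _   = refl

  update-mix : ∀ p u → p u ≡ 1 → ∀ x → q * p x ≡ update p u q x + r * update p u 0 x
  update-mix p u pu x with x ≟ u
  ... | yes refl = trans (cong (q *_) pu) (trans (*-identityʳ q) (sym (trans (cong (q +_) (*-zeroʳ r)) (+-identityʳ q))))
  ... | no  _    = refl

  ∏-update-∉ : ∀ p u t e → ListAll.All (u ≢_) e → ∏ e (update p u t) ≡ ∏ e p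
  ∏-update-∉ p u t []      []         = refl
  ∏-update-∉ p u t (x ∷ e) (u≢x ∷ u∉) = cong₂ _*_ (update-≢ p u t (u≢x ∘ sym)) (∏-update-∉ p u t e u∉)

  -- The product is linear in the weight of `u`, or free of it, because `u` occurs at most once.
  -- Weight `q` with probability 1 / q and weight 0 otherwise have mean 1, the weight of an
  -- undecided vertex.
  ∏-update-mix : ∀ p u → p u ≡ 1 → ∀ e → Unique e →
    q * ∏ e p ≡ ∏ e (update p u q) + r * ∏ e (update p u 0)
  ∏-update-mix p u pu []      []         = refl
  ∏-update-mix p u pu (x ∷ e) (x∉ ∷ uniq) with x ≟ u
  ... | yes refl = begin
    q * (p x * ∏ e p)
      ≡⟨ cong (λ t → q * (t * ∏ e p)) pu ⟩
    q * (1 * ∏ e p)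
      ≡⟨ rearrange q r (∏ e p) ⟩
    q * ∏ e p + r * 0
      ≡⟨ cong (λ t → q * t + r * 0) (∏-update-∉ p x q e x∉) ⟨
    q * ∏ e (update p x q) + r * 0 ∎
    where
    open ≡-Reasoning
    rearrange : ∀ q r y → q * (1 * y) ≡ q * y + r * 0
    rearrange = solve-∀
  ... | no _ = begin
    q * (p x * ∏ e p)
      ≡⟨ out q (p x) (∏ e p) ⟩
    p x * (q * ∏ e p)
      ≡⟨ cong (p x *_) (∏-update-mix p u pu e uniq) ⟩
    p x * (∏ e (update p u q) + r * ∏ e (update p u 0))
      ≡⟨ into (p x) (∏ e (update p u q)) r (∏ e (update p u 0)) ⟩
    p x * ∏ e (update p u q) + r * (p x * ∏ e (update p u 0)) ∎
    where
    open ≡-Reasoning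
    out : ∀ q a b → q * (a * b) ≡ a * (q * b)
    out = solve-∀
    into : ∀ a b r c → a * (b + r * c) ≡ a * b + r * (a * c)
    into = solve-∀

  module _ (κ : ℕ) (xs : List X) (es : List (List X))
           (es-unique : ∀ {e} → e ∈ es → Unique e) (es-size : ∀ {e} → e ∈ es → length e ≡ suc κ) where

    -- Once all is decided, each selected vertex adds q ^ suc κ to `gain` and each completely
    -- selected edge adds q ^ suc κ to `loss`: their difference is then a fixed multiple of vertices
    -- minus surviving edges.
    gain loss : (X → ℕ) → ℕ
    gain p = q ^ κ * ∑ xs p
    loss p = ∑ es (λ e → ∏ e p)

    gain-mix : ∀ p u → p u ≡ 1 → q * gain p ≡ gain (update p u q) + r * gain (update p u 0)
    gain-mix p u pu = begin
      q * (q ^ κ * ∑ xs p)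
        ≡⟨ out q (q ^ κ) (∑ xs p) ⟩
      q ^ κ * (q * ∑ xs p)
        ≡⟨ cong (q ^ κ *_) (trans (sym (∑-*ˡ xs q p)) (trans (∑-cong xs (update-mix p u pu))
             (trans (∑-+ xs _ _) (cong (∑ xs (update p u q) +_) (∑-*ˡ xs r _))))) ⟩
      q ^ κ * (∑ xs (update p u q) + r * ∑ xs (update p u 0))
        ≡⟨ into (q ^ κ) (∑ xs (update p u q)) r (∑ xs (update p u 0)) ⟩
      gain (update p u q) + r * gain (update p u 0) ∎
      where
      open ≡-Reasoning
      out : ∀ q a b → q * (a * b) ≡ a * (q * b)
      out = solve-∀
      into : ∀ a b r c → a * (b + r * c) ≡ a * b + r * (a * c)
      into = solve-∀

    loss-mix : ∀ p u → p u ≡ 1 → q * loss p ≡ loss (update p u q) + r * loss (update p u 0)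
    loss-mix p u pu = go es es-unique
      where
      open ≡-Reasoning
      go : ∀ es → (∀ {e} → e ∈ es → Unique e) → q * ∑ es (λ e → ∏ e p) ≡
        ∑ es (λ e → ∏ e (update p u q)) + r * ∑ es (λ e → ∏ e (update p u 0))
      go []       uniq = trans (*-zeroʳ q) (sym (*-zeroʳ r))
      go (e ∷ es) uniq = begin
        q * (∏ e p + ∑ es (λ e → ∏ e p))
          ≡⟨ *-distribˡ-+ q (∏ e p) _ ⟩
        q * ∏ e p + q * ∑ es (λ e → ∏ e p)
          ≡⟨ cong₂ _+_ (∏-update-mix p u pu e (uniq (here refl))) (go es (uniq ∘ there)) ⟩
        (a + r * b) + (c + r * d)
          ≡⟨ regroup a b c d r ⟩
        (a + c) + r * (b + d) ∎
        where
        a = ∏ e (update p u q)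
        b = ∏ e (update p u 0)
        c = ∑ es (λ e → ∏ e (update p u q))
        d = ∑ es (λ e → ∏ e (update p u 0))
        regroup : ∀ a b c d r → (a + r * b) + (c + r * d) ≡ (a + c) + r * (b + d)
        regroup = solve-∀

    -- The second clause protects vertices decided earlier from the rest of the recursion; the third
    -- says that gain minus loss has not dropped.
    Decides : List X → (X → ℕ) → (X → ℕ) → Set
    Decides U p p′ = (∀ {x} → x ∈ U → p′ x ≡ 0 ⊎ p′ x ≡ q) ×
      (∀ {x} → ListAll.All (x ≢_) U → p′ x ≡ p x) × gain p + loss p′ ≤ loss p + gain p′

    decide : ∀ U → Unique U → ∀ p → (∀ {x} → x ∈ U → p x ≡ 1) → ∃ (Decides U p)
    decide []      []          p p≡1 = p , (λ ()) , (λ _ → refl) , ≤-reflexive (+-comm (gain p) (loss p))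
    decide (u ∷ U) (u∉ ∷ uniq) p p≡1 =
      choose (mixture-choice r (gain p) (loss p) _ _ _ _ (gain-mix p u (p≡1 (here refl))) (loss-mix p u (p≡1 (here refl))))
      where
      continue : ∀ t → t ≡ 0 ⊎ t ≡ q → gain p + loss (update p u t) ≤ loss p + gain (update p u t) →
        ∃ (Decides (u ∷ U) p)
      continue t t∈ le with decide U uniq (update p u t)
                              (λ x∈ → trans (update-≢ p u t (ListAll.lookup u∉ x∈ ∘ sym)) (p≡1 (there x∈)))
      ... | p′ , values , same , le′ = p′ ,
        (λ { (here refl) → subst (λ v → v ≡ 0 ⊎ v ≡ q) (sym (trans (same u∉) (update-≡ p u t))) t∈
           ; (there x∈)  → values x∈ }) ,
        (λ { (x≢u ∷ x∉) → trans (same x∉) (update-≢ p u t x≢u) }) ,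
        +-cancelʳ-≤ (gain pₜ + loss pₜ) (gain p + loss p′) (loss p + gain p′) (begin
          gain p + loss p′ + (gain pₜ + loss pₜ)     ≡⟨ swap₁ (gain p) (loss p′) (gain pₜ) (loss pₜ) ⟩
          (gain p + loss pₜ) + (gain pₜ + loss p′)   ≤⟨ +-mono-≤ le le′ ⟩
          (loss p + gain pₜ) + (loss pₜ + gain p′)   ≡⟨ swap₂ (loss p) (gain pₜ) (loss pₜ) (gain p′) ⟩
          loss p + gain p′ + (gain pₜ + loss pₜ)     ∎)
        where
        open ≤-Reasoning
        pₜ : X → ℕ
        pₜ = update p u t
        swap₁ : ∀ a b c d → a + b + (c + d) ≡ (a + d) + (c + b)
        swap₁ = solve-∀
        swap₂ : ∀ a b c d → (a + b) + (c + d) ≡ a + d + (b + c)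
        swap₂ = solve-∀

      choose : gain p + loss (update p u q) ≤ loss p + gain (update p u q) ⊎
               gain p + loss (update p u 0) ≤ loss p + gain (update p u 0) → ∃ (Decides (u ∷ U) p)
      choose (inj₁ le) = continue q (inj₂ refl) le
      choose (inj₂ le) = continue 0 (inj₁ refl) le

    isHead : X → List X → Bool
    isHead x []      = false
    isHead x (y ∷ _) = ⌊ x ≟ y ⌋

    -- An edge that survives is destroyed by removing its head, so the cost is at most one vertex
    -- per surviving edge.
    ∑-isHead : ∀ ys → Unique ys → ∀ e b → ∑ ys (λ x → ⟦ isHead x e ∧ b ⟧) ≤ ⟦ b ⟧
    ∑-isHead ys uniq []      b = ≤-trans (≤-reflexive (∑-zero∈ ys λ _ → refl)) z≤n
    ∑-isHead []       _           (y ∷ e) b = z≤n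
    ∑-isHead (x ∷ ys) (x∉ ∷ uniq) (y ∷ e) b with x ≟ y
    ... | no  _    = ∑-isHead ys uniq (y ∷ e) b
    ... | yes refl = ≤-reflexive (trans (cong (⟦ b ⟧ +_) (∑-zero∈ ys others)) (+-identityʳ ⟦ b ⟧))
      where
      others : ∀ {z} → z ∈ ys → ⟦ ⌊ z ≟ x ⌋ ∧ b ⟧ ≡ 0
      others {z} z∈ with z ≟ x
      ... | yes z≡x = contradiction (sym z≡x) (ListAll.lookup x∉ z∈)
      ... | no  _   = refl

    ∏-all : (p : X → ℕ) (e : List X) → T (all (λ x → p x ℕ.≡ᵇ q) e) → ∏ e p ≡ q ^ length e
    ∏-all p []      t = refl
    ∏-all p (x ∷ e) t = let px , pe = Equivalence.to (T-∧ {x = p x ℕ.≡ᵇ q}) t in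
      cong₂ _*_ (≡ᵇ⇒≡ (p x) q px) (∏-all p e pe)

    ∏-one : (e : List X) → ∏ e (λ _ → 1) ≡ 1
    ∏-one []      = refl
    ∏-one (x ∷ e) = trans (+-identityʳ _) (∏-one e)

    -- At weight 1 everywhere, gain minus loss is `q ^ κ * length xs` minus `length es`, and
    -- deciding does not lower it. Removing the heads of the surviving edges costs no more than
    -- `loss` has already charged for these edges.
    independent-set : Unique xs → ∃ λ (A : X → Bool) →
      (∀ {e} → e ∈ es → ¬ ListAll.All (T ∘ A) e) ×
      q ^ κ * length xs ≤ length es + q ^ suc κ * ∑ xs (⟦_⟧ ∘ A)
    independent-set uniq = A , independent , large
      where
      decided = decide xs uniq (λ _ → 1) (λ _ → refl)
      p : X → ℕ
      p = proj₁ decided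
      A₀ A : X → Bool
      A₀ x = p x ℕ.≡ᵇ q
      removed : X → List X → Bool
      removed x e = isHead x e ∧ all A₀ e
      A x = A₀ x ∧ not (any (removed x) es)
      D a : ℕ
      D = ∑ es (λ e → ⟦ all A₀ e ⟧)
      a = ∑ xs (⟦_⟧ ∘ A)

      independent : ∀ {e} → e ∈ es → ¬ ListAll.All (T ∘ A) e
      independent {[]}    e∈ _          = contradiction (es-size e∈) λ ()
      independent {x ∷ e} e∈ all-A@(Ax ∷ _) = not-both (any (removed x) es)
        (any-intro (removed x) e∈ (Equivalence.from (T-∧ {x = isHead x (x ∷ e)}) (fromWitness refl ,
          ListAllₚ.all⁻ A₀ (ListAll.map (λ {y} t → proj₁ (Equivalence.to (T-∧ {x = A₀ y}) t)) all-A))))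
        (proj₂ (Equivalence.to (T-∧ {x = A₀ x}) Ax))
        where
        not-both : ∀ b → T b → ¬ T (not b)
        not-both true _ ()

      gain≤ : gain p ≤ q ^ κ * (q * (a + D))
      gain≤ = *-monoʳ-≤ (q ^ κ) (begin
        ∑ xs p                        ≤⟨ ∑-mono∈ xs p≤ ⟩
        ∑ xs (λ x → q * ⟦ A₀ x ⟧)     ≡⟨ ∑-*ˡ xs q _ ⟩
        q * ∑ xs (⟦_⟧ ∘ A₀)           ≤⟨ *-monoʳ-≤ q (≤-trans (∑-mono xs A₀≤) (≤-reflexive (∑-+ xs _ _))) ⟩
        q * (a + ∑ xs (λ x → ∑ es (λ e → ⟦ removed x e ⟧)))
          ≡⟨ cong (λ t → q * (a + t)) (∑-swap xs es _) ⟩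
        q * (a + ∑ es (λ e → ∑ xs (λ x → ⟦ removed x e ⟧)))
          ≤⟨ *-monoʳ-≤ q (+-monoʳ-≤ a (∑-mono es λ e → ∑-isHead xs uniq e (all A₀ e))) ⟩
        q * (a + D)                   ∎)
        where
        open ≤-Reasoning
        p≤ : ∀ {x} → x ∈ xs → p x ≤ q * ⟦ A₀ x ⟧
        p≤ {x} x∈ with proj₁ (proj₂ decided) x∈
        ... | inj₁ p≡0 = ≤-trans (≤-reflexive p≡0) z≤n
        ... | inj₂ p≡q = ≤-reflexive (trans p≡q (sym (trans
          (cong (λ b → q * ⟦ b ⟧) (Equivalence.to (T-≡ {A₀ x}) (≡⇒≡ᵇ (p x) q p≡q))) (*-identityʳ q))))
        A₀≤ : ∀ x → ⟦ A₀ x ⟧ ≤ ⟦ A x ⟧ + ∑ es (λ e → ⟦ removed x e ⟧)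
        A₀≤ x = kept-or-removed (A₀ x) (any (removed x) es) refl
          where
          kept-or-removed : ∀ b c → any (removed x) es ≡ c → ⟦ b ⟧ ≤ ⟦ b ∧ not c ⟧ + ∑ es (λ e → ⟦ removed x e ⟧)
          kept-or-removed false c     eq = z≤n
          kept-or-removed true  false eq = s≤s z≤n
          kept-or-removed true  true  eq = positive es (subst T (sym eq) tt)
            where
            positive : ∀ es → T (any (removed x) es) → 1 ≤ ∑ es (λ e → ⟦ removed x e ⟧)
            positive (e ∷ es) t with removed x e
            ... | true  = s≤s z≤n
            ... | false = positive es t

      loss≥ : q ^ suc κ * D ≤ loss p
      loss≥ = ≤-trans (≤-reflexive (sym (∑-*ˡ es (q ^ suc κ) _))) (∑-mono∈ es per-edge)
        where
        per-edge : ∀ {e} → e ∈ es → q ^ suc κ * ⟦ all A₀ e ⟧ ≤ ∏ e p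
        per-edge {e} e∈ with all A₀ e in eq
        ... | false = ≤-trans (≤-reflexive (*-zeroʳ (q ^ suc κ))) z≤n
        ... | true  = ≤-reflexive (trans (*-identityʳ (q ^ suc κ))
          (sym (trans (∏-all p e (subst T (sym eq) tt)) (cong (q ^_) (es-size {e} e∈)))))

      large : q ^ κ * length xs ≤ length es + q ^ suc κ * a
      large = +-cancelʳ-≤ (q ^ suc κ * D) _ _ (begin
        q ^ κ * length xs + q ^ suc κ * D
          ≤⟨ +-mono-≤ (≤-reflexive (cong (q ^ κ *_) (sym (trans (∑-const xs 1) (*-identityʳ _))))) loss≥ ⟩
        gain (λ _ → 1) + loss p
          ≤⟨ proj₂ (proj₂ (proj₂ decided)) ⟩
        loss (λ _ → 1) + gain p
          ≤⟨ +-mono-≤ (≤-reflexive (trans (∑-cong es ∏-one) (trans (∑-const es 1) (*-identityʳ _)))) gain≤ ⟩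
        length es + q ^ κ * (q * (a + D))
          ≡⟨ regroup (length es) (q ^ κ) q a D ⟩
        length es + q ^ suc κ * a + q ^ suc κ * D ∎)
        where
        open ≤-Reasoning
        regroup : ∀ l x q a D → l + x * (q * (a + D)) ≡ l + q * x * a + q * x * D
        regroup = solve-∀

-- Boxes as edges of a hypergraph

index-≟ : ∀ {d} {ns : Vec ℕ d} → DecidableEquality (Index ns)
index-≟ []       []       = yes refl
index-≟ (i ∷ is) (j ∷ js) with i Finₚ.≟ j | index-≟ is js
... | yes refl | yes refl = yes refl
... | no  i≢j  | _        = no λ { refl → i≢j refl }
... | _        | no is≢js = no λ { refl → is≢js refl }

toList-unique : ∀ {n k} {v : Vec (Fin n) k} → AllPairs Fin._<_ v → Unique (toList v)
toList-unique []      = []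
toList-unique (r ∷ s) = distinct r ∷ toList-unique s
  where
  distinct : ∀ {n k} {x : Fin n} {v : Vec (Fin n) k} → All (x Fin.<_) v → ListAll.All (x ≢_) (toList v)
  distinct []       = []
  distinct (lt ∷ r) = (λ { refl → <-irrefl refl lt }) ∷ distinct r

allFin-sorted : ∀ n → ListAllPairs.AllPairs Fin._<_ (allFin n)
allFin-sorted n = ListAllPairsₚ.tabulate⁺-< id

subs-complete : ∀ {n k} (xs : List (Fin n)) (v : Vec (Fin n) k) → ListAllPairs.AllPairs Fin._<_ xs →
  AllPairs Fin._<_ v → All (_∈ xs) v → v ∈ subs k xs
subs-complete xs       []      sx sv       ∈xs        = here refl
subs-complete []       (y ∷ v) sx sv       (() ∷ _)
subs-complete (x ∷ xs) (y ∷ v) (rx ∷ sx) (ry ∷ sv) (y∈ ∷ v∈) with y∈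
... | here refl = ∈-++⁺ˡ (∈-map⁺ (x ∷_) (subs-complete xs v sx sv (beyond v v∈ ry)))
  where
  beyond : ∀ {k} (v : Vec _ k) → All (_∈ x ∷ xs) v → All (x Fin.<_) v → All (_∈ xs) v
  beyond []      []              []        = []
  beyond (z ∷ v) (here refl ∷ _) (lt ∷ _)  = contradiction lt (<-irrefl refl)
  beyond (z ∷ v) (there z∈ ∷ v∈) (_ ∷ lts) = z∈ ∷ beyond v v∈ lts
... | there y∈′ = ∈-++⁺ʳ (map (x ∷_) (subs _ xs))
  (subs-complete xs (y ∷ v) sx (ry ∷ sv) (y∈′ ∷ beyond v v∈ ry))
  where
  beyond : ∀ {k} (v : Vec _ k) → All (_∈ x ∷ xs) v → All (y Fin.<_) v → All (_∈ xs) v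
  beyond []      []              []        = []
  beyond (z ∷ v) (here refl ∷ _) (lt ∷ _)  = contradiction (<-trans lt (ListAll.lookup rx y∈′)) (<-irrefl refl)
  beyond (z ∷ v) (there z∈ ∷ v∈) (_ ∷ lts) = z∈ ∷ beyond v v∈ lts

entries : ∀ {d n} {ks : Vec ℕ d} → Box (Fin n) ks → List (Index (cube d n))
entries []      = [ [] ]
entries (v ∷ e) = cartesianProductWith _∷_ (toList v) (entries e)

length-entries : ∀ {d n} {ks : Vec ℕ d} (e : Box (Fin n) ks) → length (entries e) ≡ product ks
length-entries []      = refl
length-entries (v ∷ e) =
  trans (length-cartesian _∷_ (toList v) (entries e)) (cong₂ _*_ (Vecₚ.length-toList v) (length-entries e))

entries-unique : ∀ {d n} {ks : Vec ℕ d} {e : Box (Fin n) ks} → e ∈ boxes ks (allFin n) → Unique (entries e)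
entries-unique {ks = []}     {[]}    e∈ = [] ∷ []
entries-unique {n = n} {ks = k ∷ ks} {v ∷ e} e∈ with ∈-cartesianProductWith⁻ _∷_ (subs k (allFin n)) (boxes ks (allFin n)) e∈
... | _ , _ , v∈ , e∈′ , refl = Uniqueₚ.cartesianProductWith⁺ _∷_ (λ { refl → refl , refl })
  (toList-unique (subs-sorted k (allFin n) v∈ (allFin-sorted n))) (entries-unique e∈′)

-- The rows that a selection assigns to one block of the Kronecker product.
blockBox : ∀ {d k n} (ks : Vec ℕ d) → Selection (zipWith _*_ (cube d k) ks) (cube d n) →
  Index (cube d k) → Box (Fin n) ks
blockBox []       []            []       = []
blockBox (m ∷ ks) ((v , _) ∷ σ) (i ∷ is) = tabulate (lookup v ∘ combine i) ∷ blockBox ks σ is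

blockBox-∈ : ∀ {d k n} (ks : Vec ℕ d) (σ : Selection (zipWith _*_ (cube d k) ks) (cube d n)) is →
  blockBox ks σ is ∈ boxes ks (allFin n)
blockBox-∈ []       []            []       = here refl
blockBox-∈ {n = n} (m ∷ ks) ((v , s) ∷ σ) (i ∷ is) = ∈-cartesianProductWith⁺ _∷_
  (subs-complete (allFin n) _ (allFin-sorted n)
    (tabulate-sorted λ {q} {q′} q<q′ → sorted-lookup s (combine i q) (combine i q′)
      (subst₂ _<_ (sym (Finₚ.toℕ-combine i q)) (sym (Finₚ.toℕ-combine i q′)) (+-monoʳ-< (m * toℕ i) q<q′)))
    (VecAllₚ.tabulate⁺ λ q → ∈-allFin _))
  (blockBox-∈ ks σ is)

∈-toList-tabulate : ∀ {m} (h : Fin m → X) {x} → x ∈ toList (tabulate h) → ∃ λ q → x ≡ h q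
∈-toList-tabulate {m = suc m} h (here refl) = zero , refl
∈-toList-tabulate {m = suc m} h (there x∈)  = let q , eq = ∈-toList-tabulate (h ∘ suc) x∈ in suc q , eq

∈-entries-blockBox : ∀ {d k n} (ks : Vec ℕ d) (σ : Selection (zipWith _*_ (cube d k) ks) (cube d n)) is {y} →
  y ∈ entries (blockBox ks σ is) → ∃ λ j → proj₁ (blockIndex (cube d k) ks j) ≡ is × select σ j ≡ y
∈-entries-blockBox []       []            []       (here refl) = [] , refl , refl
∈-entries-blockBox (m ∷ ks) ((v , s) ∷ σ) (i ∷ is) y∈
  with ∈-cartesianProductWith⁻ _∷_ (toList (tabulate (lookup v ∘ combine i))) (entries (blockBox ks σ is)) y∈
... | _ , _ , x∈ , y∈′ , refl =
  let q , x≡      = ∈-toList-tabulate (lookup v ∘ combine i) x∈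
      j , j≡ , y≡ = ∈-entries-blockBox ks σ is y∈′
  in  combine i q ∷ j , cong₂ _∷_ (cong proj₁ (Finₚ.remQuot-combine i q)) j≡ , cong₂ _∷_ (sym x≡) y≡

-- A copy of `P ⊗ R ks` has a full box at the block of the one `i`, so it is enough to destroy all
-- full boxes. Vertices are the n ^ d entries, edges the at most n ^ sum ks boxes with `product ks`
-- entries each.
avoider : ∀ {d} k n (P : Matrix (cube d k)) i → P i ≡ true → (ks : Vec ℕ d) → ∀ r κ → product ks ≡ suc κ →
  ∃ λ (A : Matrix (cube d n)) → Avoids A (P ⊗ R ks) ×
    suc r ^ κ * n ^ d ≤ n ^ sum ks + suc r ^ suc κ * ones A
avoider {d} k n P i Pi ks r κ size = A , avoids , (begin
  suc r ^ κ * n ^ d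
    ≡⟨ cong (suc r ^ κ *_) (sym (length-allIndices d)) ⟩
  suc r ^ κ * length (allIndices (cube d n))
    ≤⟨ proj₂ (proj₂ independent) ⟩
  length es + suc r ^ suc κ * ∑ (allIndices (cube d n)) (⟦_⟧ ∘ A)
    ≤⟨ +-mono-≤ length-es (≤-reflexive (cong (suc r ^ suc κ *_) (sym (length-filterᵇ A (allIndices (cube d n)))))) ⟩
  n ^ sum ks + suc r ^ suc κ * ones A ∎)
  where
  open ≤-Reasoning
  open Deletion (index-≟ {ns = cube d n}) r using (independent-set)
  es : List (List (Index (cube d n)))
  es = map entries (boxes ks (allFin n))
  es-unique : ∀ {e} → e ∈ es → Unique e
  es-unique e∈ with ∈-map⁻ entries e∈
  ... | _ , b∈ , refl = entries-unique b∈
  es-size : ∀ {e} → e ∈ es → length e ≡ suc κ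
  es-size e∈ with ∈-map⁻ entries e∈
  ... | b , _ , refl = trans (length-entries b) size
  allIndices-unique : ∀ d → Unique (allIndices (cube d n))
  allIndices-unique zero    = [] ∷ []
  allIndices-unique (suc d) = Uniqueₚ.cartesianProductWith⁺ _∷_ (λ { refl → refl , refl })
    (Uniqueₚ.allFin⁺ n) (allIndices-unique d)
  length-allIndices : ∀ d → length (allIndices (cube d n)) ≡ n ^ d
  length-allIndices zero    = refl
  length-allIndices (suc d) = trans (length-cartesian _∷_ (allFin n) (allIndices (cube d n)))
    (cong₂ _*_ (Listₚ.length-tabulate {n = n} id) (length-allIndices d))
  length-es : length es ≤ n ^ sum ks
  length-es = subst₂ (λ l m → l ≤ m ^ sum ks) (sym (Listₚ.length-map entries (boxes ks (allFin n))))
    (Listₚ.length-tabulate {n = n} id) (length-boxes ks (allFin n))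
  independent = independent-set κ (allIndices (cube d n)) es es-unique es-size (allIndices-unique d)
  A : Matrix (cube d n)
  A = proj₁ independent
  avoids : Avoids A (P ⊗ R ks)
  avoids (σ , le) = proj₁ (proj₂ independent) (∈-map⁺ entries (blockBox-∈ ks σ i)) (ListAll.tabulate one)
    where
    one : ∀ {y} → y ∈ entries (blockBox ks σ i) → T (A y)
    one y∈ with ∈-entries-blockBox ks σ i y∈
    ... | j , refl , refl = above (le j) (cong (λ b → if b then true else false) Pi)
      where
      above : ∀ {b c} → b Bool.≤ c → b ≡ true → T c
      above Bool.b≤b refl = tt

-- An `e`-th root rounded up to an integer. Raising a positive base by 1 at most doubles it, whence
-- the factor `2 ^ e`.
root-above : ∀ e .{{_ : NonZero e}} t .{{_ : NonZero t}} → ∃ λ r → t ≤ suc r ^ e × suc r ^ e ≤ 2 ^ e * t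
root-above e (suc zero) = 0 , ≤-reflexive (sym (^-zeroˡ e)) ,
  ≤-trans (^-monoˡ-≤ e (s≤s z≤n)) (≤-reflexive (sym (*-identityʳ (2 ^ e))))
root-above e (suc (suc t)) with root-above e (suc t)
... | r , lo , hi with m≤n⇒m<n∨m≡n lo
... | inj₁ lt = r , lt , ≤-trans hi (*-monoʳ-≤ (2 ^ e) (n≤1+n (suc t)))
... | inj₂ eq = suc r ,
  (begin
    suc (suc t)              ≡⟨ cong suc eq ⟩
    suc (suc r ^ e)          ≤⟨ ^-monoˡ-< e (n<1+n (suc r)) ⟩
    suc (suc r) ^ e          ∎) ,
  (begin
    suc (suc r) ^ e          ≤⟨ ^-monoˡ-≤ e (+-mono-≤ {1} {suc r} {suc r} {suc r + 0} (s≤s z≤n) (m≤m+n (suc r) 0)) ⟩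
    (2 * suc r) ^ e          ≡⟨ ^-distribʳ-* e 2 (suc r) ⟩
    2 ^ e * suc r ^ e        ≡⟨ cong (2 ^ e *_) eq ⟨
    2 ^ e * suc t            ≤⟨ *-monoʳ-≤ (2 ^ e) (n≤1+n (suc t)) ⟩
    2 ^ e * suc (suc t)      ∎)
  where open ≤-Reasoning

-- Rational exponents in terms of integer powers

toℚᵘ-toℚ : ∀ n → ℚ.toℚᵘ (toℚ n) ℚᵘ.≃ ℚᵘ.mkℚᵘ (ℤ.+ n) 0
toℚᵘ-toℚ n = ℚₚ.toℚᵘ-fromℚᵘ (ℚᵘ.mkℚᵘ (ℤ.+ n) 0)

toℚ-* : ∀ m n → toℚ (m * n) ≡ toℚ m ℚ.* toℚ n
toℚ-* m n = ℚₚ.toℚᵘ-injective (begin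
  ℚ.toℚᵘ (toℚ (m * n))                            ≈⟨ toℚᵘ-toℚ (m * n) ⟩
  ℚᵘ.mkℚᵘ (ℤ.+ (m * n)) 0                         ≡⟨ cong (λ i → ℚᵘ.mkℚᵘ i 0) (ℤₚ.pos-* m n) ⟩
  ℚᵘ.mkℚᵘ (ℤ.+ m) 0 ℚᵘ.* ℚᵘ.mkℚᵘ (ℤ.+ n) 0        ≈⟨ ℚᵘₚ.*-cong (toℚᵘ-toℚ m) (toℚᵘ-toℚ n) ⟨
  ℚ.toℚᵘ (toℚ m) ℚᵘ.* ℚ.toℚᵘ (toℚ n)              ≈⟨ ℚₚ.toℚᵘ-homo-* (toℚ m) (toℚ n) ⟨
  ℚ.toℚᵘ (toℚ m ℚ.* toℚ n)                        ∎)
  where open import Relation.Binary.Reasoning.Setoid ℚᵘₚ.≃-setoid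

toℚ-^ : ∀ n b → toℚ n ^ℕ b ≡ toℚ (n ^ b)
toℚ-^ n zero    = refl
toℚ-^ n (suc b) = trans (cong (toℚ n ℚ.*_) (toℚ-^ n b)) (sym (toℚ-* n (n ^ b)))

toℚ-mono-≤ : ∀ {m n} → m ≤ n → toℚ m ℚ.≤ toℚ n
toℚ-mono-≤ {m} {n} m≤n = ℚₚ.toℚᵘ-cancel-≤ (begin
  ℚ.toℚᵘ (toℚ m)    ≃⟨ toℚᵘ-toℚ m ⟩
  ℚᵘ.mkℚᵘ (ℤ.+ m) 0 ≤⟨ ℚᵘ.*≤* (ℤₚ.*-monoʳ-≤-nonNeg (ℤ.+ 1) (ℤ.+≤+ m≤n)) ⟩
  ℚᵘ.mkℚᵘ (ℤ.+ n) 0 ≃⟨ toℚᵘ-toℚ n ⟨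
  ℚ.toℚᵘ (toℚ n)    ∎)
  where open ℚᵘₚ.≤-Reasoning

^ℕ-distrib-* : ∀ p q b → (p ℚ.* q) ^ℕ b ≡ p ^ℕ b ℚ.* q ^ℕ b
^ℕ-distrib-* p q zero    = refl
^ℕ-distrib-* p q (suc b) = begin
  p ℚ.* q ℚ.* (p ℚ.* q) ^ℕ b               ≡⟨ cong (p ℚ.* q ℚ.*_) (^ℕ-distrib-* p q b) ⟩
  p ℚ.* q ℚ.* (p ^ℕ b ℚ.* q ^ℕ b)          ≡⟨ ℚₚ.*-assoc p q _ ⟩
  p ℚ.* (q ℚ.* (p ^ℕ b ℚ.* q ^ℕ b))        ≡⟨ cong (p ℚ.*_) (sym (ℚₚ.*-assoc q (p ^ℕ b) (q ^ℕ b))) ⟩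
  p ℚ.* (q ℚ.* p ^ℕ b ℚ.* q ^ℕ b)          ≡⟨ cong (λ t → p ℚ.* (t ℚ.* q ^ℕ b)) (ℚₚ.*-comm q (p ^ℕ b)) ⟩
  p ℚ.* (p ^ℕ b ℚ.* q ℚ.* q ^ℕ b)          ≡⟨ cong (p ℚ.*_) (ℚₚ.*-assoc (p ^ℕ b) q (q ^ℕ b)) ⟩
  p ℚ.* (p ^ℕ b ℚ.* (q ℚ.* q ^ℕ b))        ≡⟨ ℚₚ.*-assoc p (p ^ℕ b) _ ⟨
  p ℚ.* p ^ℕ b ℚ.* (q ℚ.* q ^ℕ b)          ∎
  where open ≡-Reasoning

1^ℕ : ∀ b → 1ℚ ^ℕ b ≡ 1ℚ
1^ℕ zero    = refl
1^ℕ (suc b) = trans (ℚₚ.*-identityˡ _) (1^ℕ b)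

^ℕ-nonNegative : ∀ p .{{_ : ℚ.NonNegative p}} b → ℚ.NonNegative (p ^ℕ b)
^ℕ-nonNegative p zero    = _
^ℕ-nonNegative p (suc b) = ℚₚ.nonNeg*nonNeg⇒nonNeg p (p ^ℕ b) {{^ℕ-nonNegative p b}}

toℚᵘ-exponent : ∀ d S e .{{_ : NonZero e}} → S ≤ d * e →
  ℚ.toℚᵘ (toℚ d ℚ.- (ℤ.+ S) ℚ./ e) ℚᵘ.≃ (ℤ.+ (d * e ∸ S)) ℚᵘ./ e
toℚᵘ-exponent d S e@(suc e-1) S≤ = begin
  ℚ.toℚᵘ (toℚ d ℚ.- (ℤ.+ S) ℚ./ e)
    ≈⟨ ℚₚ.toℚᵘ-homo-+ (toℚ d) (ℚ.- ((ℤ.+ S) ℚ./ e)) ⟩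
  ℚ.toℚᵘ (toℚ d) ℚᵘ.+ ℚ.toℚᵘ (ℚ.- ((ℤ.+ S) ℚ./ e))
    ≈⟨ ℚᵘₚ.+-cong (toℚᵘ-toℚ d) (ℚᵘₚ.≃-trans (ℚₚ.toℚᵘ-homo‿- ((ℤ.+ S) ℚ./ e))
         (ℚᵘₚ.-‿cong (ℚₚ.toℚᵘ-fromℚᵘ (ℚᵘ.mkℚᵘ (ℤ.+ S) e-1)))) ⟩
  ℚᵘ.mkℚᵘ (ℤ.+ d) 0 ℚᵘ.- ℚᵘ.mkℚᵘ (ℤ.+ S) e-1
    ≈⟨ ℚᵘ.*≡* (cong₂ ℤ._*_ numerator (cong (λ t → ℤ.+ t) (sym (+-identityʳ e)))) ⟩
  ℚᵘ.mkℚᵘ (ℤ.+ (d * e ∸ S)) e-1 ∎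
  where
  open import Relation.Binary.Reasoning.Setoid ℚᵘₚ.≃-setoid
  numerator : (ℤ.+ d) ℤ.* (ℤ.+ e) ℤ.+ (ℤ.- (ℤ.+ S)) ℤ.* (ℤ.+ 1) ≡ ℤ.+ (d * e ∸ S)
  numerator = trans (cong₂ ℤ._+_ (sym (ℤₚ.pos-* d e)) (ℤₚ.*-identityʳ (ℤ.- (ℤ.+ S))))
    (trans (ℤₚ.m-n≡m⊖n (d * e) S) (ℤₚ.⊖-≥ S≤))

-- The relations for n ^ r use r in lowest terms, whereas the bounds have denominator `e`; cross
-- multiplication links the two and rules out a negative numerator.
exponent-form : ∀ r a e .{{_ : NonZero e}} → ℚ.toℚᵘ r ℚᵘ.≃ (ℤ.+ a) ℚᵘ./ e →
  ∃ λ p → ↥ r ≡ ℤ.+ p × p * e ≡ a * ↧ₙ r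
exponent-form r@(ℚ.mkℚ (ℤ.+ p) _ _) a e@(suc _) (ℚᵘ.*≡* eq) = p , refl ,
  ℤₚ.+-injective (trans (ℤₚ.pos-* p e) (trans eq (sym (ℤₚ.pos-* a (↧ₙ r)))))
exponent-form r@(ℚ.mkℚ -[1+ p ] _ _) a e@(suc _) (ℚᵘ.*≡* eq) =
  case trans eq (sym (ℤₚ.pos-* a (↧ₙ r))) of λ ()

-- The `b`-th power of the hypothesis is an inequality between `e`-th powers, so the `e`-th root can
-- be taken.
power-≤-lift : ∀ {x y} b e .{{_ : NonZero e}} → x ^ e ≤ y → ∀ {z} → y ^ b ≡ z ^ e → x ^ b ≤ z
power-≤-lift {x} {y} b e le {z} eq = ^-cancelʳ-≤ e (begin
  (x ^ b) ^ e ≡⟨ ^-swap x b e ⟩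
  (x ^ e) ^ b ≤⟨ ^-monoˡ-≤ b le ⟩
  y ^ b       ≡⟨ eq ⟩
  z ^ e       ∎)
  where open ≤-Reasoning

module _ (d S e : ℕ) .{{_ : NonZero e}} (S≤ : S ≤ d * e) (n : ℕ) .{{_ : NonZero n}} where

  private
    r : ℚ
    r = toℚ d ℚ.- (ℤ.+ S) ℚ./ e
    b a : ℕ
    b = ↧ₙ r
    a = d * e ∸ S
    form = exponent-form r a e (toℚᵘ-exponent d S e S≤)
    p : ℕ
    p = proj₁ form
    n^p^e : (n ^ p) ^ e ≡ (n ^ a) ^ b
    n^p^e = trans (^-*-assoc n p e) (trans (cong (n ^_) (proj₂ (proj₂ form))) (sym (^-*-assoc n a b)))
    n^de : (n ^ d) ^ e ≡ n ^ a * n ^ S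
    n^de = trans (^-*-assoc n d e) (trans (cong (n ^_) (sym (m∸n+n≡m S≤))) (^-distribˡ-+-* n a S))
    instance _ = m^n≢0 n S

  -- The hypothesis is the desired bound raised to the power `e` and cleared of its negative
  -- exponent.
  ≤ʳ-intro : ∀ M c → M ^ e * n ^ S ≤ (c * n ^ d) ^ e → M ≤ʳ toℚ c · n ^ r
  ≤ʳ-intro M c le = subst₂ ℚ._≤_ (sym (toℚ-^ M b))
    (trans (toℚ-* (c ^ b) (n ^ p)) (cong₂ ℚ._*_ (sym (toℚ-^ c b)) (cong (n ^ℤ_) (sym (proj₁ (proj₂ form))))))
    (toℚ-mono-≤ (power-≤-lift {M} {c ^ e * n ^ a} b e root-free powers))
    where
    open ≤-Reasoning
    root-free : M ^ e ≤ c ^ e * n ^ a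
    root-free = *-cancelʳ-≤ _ _ (n ^ S) (begin
      M ^ e * n ^ S             ≤⟨ le ⟩
      (c * n ^ d) ^ e           ≡⟨ ^-distribʳ-* e c (n ^ d) ⟩
      c ^ e * (n ^ d) ^ e       ≡⟨ cong (c ^ e *_) n^de ⟩
      c ^ e * (n ^ a * n ^ S)   ≡⟨ *-assoc (c ^ e) (n ^ a) (n ^ S) ⟨
      c ^ e * n ^ a * n ^ S     ∎)
    powers : (c ^ e * n ^ a) ^ b ≡ (c ^ b * n ^ p) ^ e
    powers = trans (^-distribʳ-* b (c ^ e) (n ^ a))
      (trans (cong₂ _*_ (^-swap c e b) (sym n^p^e)) (sym (^-distribʳ-* e (c ^ b) (n ^ p))))

  -- The constant `C` enters through its integer reciprocal `c`, so that the hypothesis again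
  -- concerns natural numbers.
  ʳ≤-intro : ∀ M c C .{{_ : ℚ.NonNegative C}} → C ℚ.* toℚ c ≡ 1ℚ →
    (n ^ d) ^ e ≤ (c * M) ^ e * n ^ S → C · n ^ r ≤ʳ M
  ʳ≤-intro M c C C*c le = begin
    C ^ℕ b ℚ.* n ^ℤ (↥ r)                   ≡⟨ cong (λ i → C ^ℕ b ℚ.* n ^ℤ i) (proj₁ (proj₂ form)) ⟩
    C ^ℕ b ℚ.* toℚ (n ^ p)                  ≤⟨ ℚₚ.*-monoˡ-≤-nonNeg (C ^ℕ b) {{^ℕ-nonNegative C b}} (toℚ-mono-≤ n^p≤) ⟩
    C ^ℕ b ℚ.* toℚ (c ^ b * M ^ b)          ≡⟨ cong (C ^ℕ b ℚ.*_) (toℚ-* (c ^ b) (M ^ b)) ⟩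
    C ^ℕ b ℚ.* (toℚ (c ^ b) ℚ.* toℚ (M ^ b)) ≡⟨ ℚₚ.*-assoc (C ^ℕ b) (toℚ (c ^ b)) (toℚ (M ^ b)) ⟨
    C ^ℕ b ℚ.* toℚ (c ^ b) ℚ.* toℚ (M ^ b)  ≡⟨ cong₂ ℚ._*_ cancel (sym (toℚ-^ M b)) ⟩
    1ℚ ℚ.* toℚ M ^ℕ b                       ≡⟨ ℚₚ.*-identityˡ _ ⟩
    toℚ M ^ℕ b                              ∎
    where
    open ℚₚ.≤-Reasoning
    cancel : C ^ℕ b ℚ.* toℚ (c ^ b) ≡ 1ℚ
    cancel = trans (cong (C ^ℕ b ℚ.*_) (sym (toℚ-^ c b)))
      (trans (sym (^ℕ-distrib-* C (toℚ c) b)) (trans (cong (_^ℕ b) C*c) (1^ℕ b)))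
    n^a≤ : n ^ a ≤ (c * M) ^ e
    n^a≤ = *-cancelʳ-≤ _ _ (n ^ S) (≤-trans (≤-reflexive (sym n^de)) le)
    n^p≤ : n ^ p ≤ c ^ b * M ^ b
    n^p≤ = ^-cancelʳ-≤ e (≤-trans (≤-reflexive n^p^e) (≤-trans (^-monoˡ-≤ b n^a≤)
      (≤-reflexive (trans (^-swap (c * M) e b) (cong (_^ e) (^-distribʳ-* b c M))))))

-- Arithmetic of the side lengths, and the two bounds

maximum-attained : ∀ {d} (ks : Vec ℕ (suc d)) → ∃ λ ℓ → lookup ks ℓ ≡ maximum ks
maximum-attained (k ∷ [])          = zero , sym (⊔-identityʳ k)
maximum-attained (k ∷ ks@(_ ∷ _)) with ⊔-sel k (maximum ks) | maximum-attained ks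
... | inj₁ eq | _      = zero , sym eq
... | inj₂ eq | ℓ , eq′ = suc ℓ , trans eq′ (sym eq)

product-[]≔1 : ∀ {d} (ks : Vec ℕ d) ℓ → product ks ≡ lookup ks ℓ * product (ks [ ℓ ]≔ 1)
product-[]≔1 (k ∷ ks) zero    = cong (k *_) (sym (*-identityˡ (product ks)))
product-[]≔1 (k ∷ ks) (suc ℓ) = trans (cong (k *_) (product-[]≔1 ks ℓ))
  (swap k (lookup ks ℓ) (product (ks [ ℓ ]≔ 1)))
  where
  swap : ∀ a b c → a * (b * c) ≡ b * (a * c)
  swap = solve-∀

lookup≤product : ∀ {d} {ks : Vec ℕ d} → All NonZero ks → ∀ ℓ → lookup ks ℓ ≤ product ks
lookup≤product {ks = ks} pos ℓ = ≤-trans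
  (m≤m*n (lookup ks ℓ) (product (ks [ ℓ ]≔ 1)) {{product≢0 (nonZero-[]≔1 pos ℓ)}})
  (≤-reflexive (sym (product-[]≔1 ks ℓ)))

other>1 : ∀ {d} {ks : Vec ℕ d} → AtLeastTwo>1 ks → ∀ ℓ → ∃ λ m → m ≢ ℓ × 1 < lookup ks m
other>1 (i , j , i≢j , 1<i , 1<j) ℓ with i Finₚ.≟ ℓ
... | no  i≢ℓ  = i , i≢ℓ , 1<i
... | yes refl = j , i≢j ∘ sym , 1<j

-- Of two sides exceeding 1, at least one remains when side `ℓ` is replaced by 1.
product-others>1 : ∀ {d} {ks : Vec ℕ d} → All NonZero ks → AtLeastTwo>1 ks → ∀ ℓ →
  1 < product (ks [ ℓ ]≔ 1)
product-others>1 {ks = ks} pos two ℓ =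
  let m , m≢ℓ , 1<m = other>1 {ks = ks} two ℓ in
  <-≤-trans (subst (1 <_) (sym (Vecₚ.lookup∘updateAt′ m ℓ m≢ℓ ks)) 1<m)
            (lookup≤product {ks = ks [ ℓ ]≔ 1} (nonZero-[]≔1 pos ℓ) m)

sum≤d*product : ∀ {d} {ks : Vec ℕ d} → All NonZero ks → sum ks ≤ d * product ks
sum≤d*product         []                    = z≤n
sum≤d*product {suc d} {k ∷ ks} (p ∷ pos) = begin
  k + sum ks                          ≤⟨ +-mono-≤ (m≤m*n k (product ks) {{product≢0 pos}}) (sum≤d*product pos) ⟩
  k * product ks + d * product ks     ≤⟨ +-monoʳ-≤ (k * product ks) (*-monoʳ-≤ d (m≤n*m (product ks) k {{p}})) ⟩
  k * product ks + d * (k * product ks) ∎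
  where open ≤-Reasoning

d≤sum : ∀ {d} {ks : Vec ℕ d} → All NonZero ks → d ≤ sum ks
d≤sum []                          = z≤n
d≤sum (_∷_ {x = suc k} p pos) = s≤s (≤-trans (d≤sum pos) (m≤n+m _ k))

-- The choice q ^ κ ≈ 2 n ^ S makes the expected number of copies at most half
-- the expected number of ones.
deletion-bound : ∀ q κ n d S M .{{_ : NonZero q}} .{{_ : NonZero κ}} →
  2 * n ^ S ≤ q ^ κ → q ^ κ ≤ 2 ^ κ * (2 * n ^ S) →
  q ^ κ * n ^ d ≤ n ^ (S + d) + q ^ suc κ * M → (n ^ d) ^ κ ≤ (8 * M) ^ κ * n ^ S
deletion-bound q κ n d S M lo hi large = begin
  (n ^ d) ^ κ
    ≤⟨ ^-monoˡ-≤ κ n^d≤ ⟩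
  (2 * M * q) ^ κ
    ≡⟨ ^-distribʳ-* κ (2 * M) q ⟩
  (2 * M) ^ κ * q ^ κ
    ≤⟨ *-monoʳ-≤ ((2 * M) ^ κ) hi ⟩
  (2 * M) ^ κ * (2 ^ κ * (2 * n ^ S))
    -- The 8 collects three factors 2: from `n^d≤`, from the rounding in `hi`, and from 2 n ^ S,
    -- whose 2 is enlarged to `2 ^ κ`.
    ≤⟨ *-monoʳ-≤ ((2 * M) ^ κ) (*-monoʳ-≤ (2 ^ κ) (*-monoˡ-≤ (n ^ S) (m≤m^n 2 κ))) ⟩
  (2 * M) ^ κ * (2 ^ κ * (2 ^ κ * n ^ S))
    ≡⟨ regroup ((2 * M) ^ κ) (2 ^ κ) (n ^ S) ⟩
  2 ^ κ * (2 ^ κ * (2 * M) ^ κ) * n ^ S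
    ≡⟨ cong (_* n ^ S) (sym (trans (cong (_^ κ) (eight M)) (trans (^-distribʳ-* κ 2 (2 * (2 * M)))
         (cong (2 ^ κ *_) (^-distribʳ-* κ 2 (2 * M)))))) ⟩
  (8 * M) ^ κ * n ^ S ∎
  where
  open ≤-Reasoning
  instance _ = m^n≢0 q κ
  regroup : ∀ x t y → x * (t * (t * y)) ≡ t * (t * x) * y
  regroup = solve-∀
  eight : ∀ m → 8 * m ≡ 2 * (2 * (2 * m))
  eight = solve-∀
  n^d≤ : n ^ d ≤ 2 * M * q
  -- Doubling `large` lets `lo` absorb the copies into one of the two terms on the left.
  n^d≤ = *-cancelˡ-≤ (q ^ κ) (+-cancelʳ-≤ (q ^ κ * n ^ d) _ _ (begin
    q ^ κ * n ^ d + q ^ κ * n ^ d             ≤⟨ +-mono-≤ large large ⟩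
    (n ^ (S + d) + q ^ suc κ * M) + (n ^ (S + d) + q ^ suc κ * M)
      ≡⟨ cong (λ t → (t + q ^ suc κ * M) + (t + q ^ suc κ * M)) (^-distribˡ-+-* n S d) ⟩
    (n ^ S * n ^ d + q * q ^ κ * M) + (n ^ S * n ^ d + q * q ^ κ * M)
      ≡⟨ collect (n ^ S) (n ^ d) q (q ^ κ) M ⟩
    q ^ κ * (2 * M * q) + 2 * n ^ S * n ^ d   ≤⟨ +-monoʳ-≤ (q ^ κ * (2 * M * q)) (*-monoˡ-≤ (n ^ d) lo) ⟩
    q ^ κ * (2 * M * q) + q ^ κ * n ^ d       ∎))
    where
    collect : ∀ s N q x M → (s * N + q * x * M) + (s * N + q * x * M) ≡ x * (2 * M * q) + 2 * s * N
    collect = solve-∀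

module _ {d k} (P : Matrix (cube (suc d) (suc k))) (perm : IsPermutation P)
         (ks : Vec ℕ (suc d)) (pos : All NonZero ks) (two : AtLeastTwo>1 ks) where

  private
    κ S : ℕ
    κ = product ks ∸ 1
    S = sum ks ∸ suc d
    instance
      _ : NonZero (product ks)
      _ = product≢0 pos
      _ : NonZero κ
      _ = product∸1≢0 pos two

    sum≡ : S + suc d ≡ sum ks
    sum≡ = m∸n+n≡m (d≤sum pos)

    avoidance : ∀ n r → ∃ λ (A : Matrix (cube (suc d) n)) → Avoids A (P ⊗ R ks) ×
      suc r ^ κ * n ^ suc d ≤ n ^ sum ks + suc r ^ suc κ * ones A
    avoidance n r = let o , Po , _ = theOne (suc d) perm zero zero in
      avoider (suc k) n P o Po ks r κ (sym (suc-pred (product ks)))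

  ones-lower : ∀ n .{{_ : NonZero n}} M → (∀ (A : Matrix (cube (suc d) n)) → Avoids A (P ⊗ R ks) → ones A ≤ M) →
    (n ^ suc d) ^ κ ≤ (8 * M) ^ κ * n ^ S
  ones-lower n M ones≤M =
    from-root (root-above κ (2 * n ^ S) {{m*n≢0 2 (n ^ S) {{_}} {{m^n≢0 n S}}}})
    where
    open ≤-Reasoning
    from-avoider : ∀ r → 2 * n ^ S ≤ suc r ^ κ → suc r ^ κ ≤ 2 ^ κ * (2 * n ^ S) →
      (∃ λ (A : Matrix (cube (suc d) n)) → Avoids A (P ⊗ R ks) ×
        suc r ^ κ * n ^ suc d ≤ n ^ sum ks + suc r ^ suc κ * ones A) →
      (n ^ suc d) ^ κ ≤ (8 * M) ^ κ * n ^ S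
    from-avoider r lo hi (A , avoids , large) = deletion-bound (suc r) κ n (suc d) S M lo hi (begin
      suc r ^ κ * n ^ suc d
        ≤⟨ large ⟩
      n ^ sum ks + suc r ^ suc κ * ones A
        ≤⟨ +-mono-≤ (≤-reflexive (cong (n ^_) (sym sum≡))) (*-monoʳ-≤ (suc r ^ suc κ) (ones≤M A avoids)) ⟩
      n ^ (S + suc d) + suc r ^ suc κ * M ∎)
    from-root : (∃ λ r → 2 * n ^ S ≤ suc r ^ κ × suc r ^ κ ≤ 2 ^ κ * (2 * n ^ S)) →
      (n ^ suc d) ^ κ ≤ (8 * M) ^ κ * n ^ S
    from-root (r , lo , hi) = from-avoider r lo hi (avoidance n r)

  -- For the direction of the largest side μ, `product ks` is E μ. Raising the bound with exponent E
  -- to the power μ gives it the denominator of `α`.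
  ones-upper : ∃ λ C → ∀ n .{{_ : NonZero n}} (A : Matrix (cube (suc d) n)) → Avoids A (P ⊗ R ks) →
    ones A ^ product ks * n ^ maximum ks ≤ (suc C * n ^ suc d) ^ product ks
  ones-upper = proj₁ upper , bound
    where
    open ≤-Reasoning
    ℓ : Fin (suc d)
    ℓ = proj₁ (maximum-attained ks)
    E μ : ℕ
    E = product (ks [ ℓ ]≔ 1)
    μ = maximum ks
    upper = boxOccurs-upper k ks pos ℓ (product-others>1 pos two ℓ)
    E*μ≡ : E * μ ≡ product ks
    E*μ≡ = trans (*-comm E μ)
      (trans (cong (_* E) (sym (proj₂ (maximum-attained ks)))) (sym (product-[]≔1 ks ℓ)))
    bound : ∀ n .{{_ : NonZero n}} (A : Matrix (cube (suc d) n)) → Avoids A (P ⊗ R ks) →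
      ones A ^ product ks * n ^ μ ≤ (suc (proj₁ upper) * n ^ suc d) ^ product ks
    bound n A avoids = subst (λ e → ones A ^ e * n ^ μ ≤ (suc (proj₁ upper) * n ^ suc d) ^ e) E*μ≡ (begin
      ones A ^ (E * μ) * n ^ μ
        ≤⟨ *-monoˡ-≤ (n ^ μ) (^-monoˡ-≤ (E * μ) (ones≤count-extend (suc d) n A)) ⟩
      c ^ (E * μ) * n ^ μ
        ≡⟨ cong (_* n ^ μ) (^-*-assoc c E μ) ⟨
      (c ^ E) ^ μ * n ^ μ
        ≡⟨ ^-distribʳ-* μ (c ^ E) n ⟨
      (c ^ E * n) ^ μ
        ≤⟨ ^-monoˡ-≤ μ (proj₂ upper (λ ℓ i → coord (suc d) i ℓ) n (extend A)
             (avoids ∘ boxOccurs⇒contains (suc d) perm ks pos A)) ⟩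
      ((suc (proj₁ upper) * n ^ suc d) ^ E) ^ μ
        ≡⟨ ^-*-assoc (suc (proj₁ upper) * n ^ suc d) E μ ⟩
      (suc (proj₁ upper) * n ^ suc d) ^ (E * μ) ∎)
      where
      c : ℕ
      c = count (extend A) n

  -- `f-attained` asks for a matrix that avoids the product; the deletion construction supplies one
  -- for any `r`.
  some-avoider : ∀ n → ∃ λ (A : Matrix (cube (suc d) n)) → Avoids A (P ⊗ R ks)
  some-avoider n = let A , avoids , _ = avoidance n 0 in A , avoids

module _ {d} (ks : Vec ℕ (suc d)) (pos : All NonZero ks) (two : AtLeastTwo>1 ks)
         (n : ℕ) .{{_ : NonZero n}} (M : ℕ) where

  private
    K κ S : ℕ
    K = product ks
    κ = K ∸ 1
    S = sum ks ∸ suc d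
    instance
      _ : NonZero K
      _ = product≢0 pos
      _ : NonZero κ
      _ = product∸1≢0 pos two

  β-lower : ∀ c C .{{_ : ℚ.NonNegative C}} → C ℚ.* toℚ c ≡ 1ℚ →
    (n ^ suc d) ^ κ ≤ (c * M) ^ κ * n ^ S → C · n ^ (toℚ (suc d) ℚ.- β ks pos two) ≤ʳ M
  β-lower c C C*c le = subst (λ b → C · n ^ (toℚ (suc d) ℚ.- b) ≤ʳ M) (sym β≡)
    (ʳ≤-intro (suc d) S κ S≤ n M c C C*c le)
    where
    open ≤-Reasoning
    β≡ : β ks pos two ≡ (ℤ.+ S) ℚ./ κ
    β≡ = cong (λ i → i ℚ./ κ) (trans (ℤₚ.m-n≡m⊖n (sum ks) (suc d)) (ℤₚ.⊖-≥ (d≤sum pos)))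
    -- This is β ≤ d for the dimension d at hand, so the exponent is not negative.
    S≤ : S ≤ suc d * κ
    S≤ = +-cancelʳ-≤ (suc d) _ _ (begin
      S + suc d              ≡⟨ m∸n+n≡m (d≤sum pos) ⟩
      sum ks                 ≤⟨ sum≤d*product pos ⟩
      suc d * K              ≡⟨ cong (suc d *_) (suc-pred K) ⟨
      suc d * suc κ          ≡⟨ trans (*-suc (suc d) κ) (+-comm (suc d) (suc d * κ)) ⟩
      suc d * κ + suc d      ∎)

  α-upper : ∀ c → M ^ K * n ^ maximum ks ≤ (c * n ^ suc d) ^ K →
    M ≤ʳ toℚ c · n ^ (toℚ (suc d) ℚ.- α ks pos)
  α-upper c = ≤ʳ-intro (suc d) (maximum ks) K μ≤ n M c
    where
    μ≤ : maximum ks ≤ suc d * K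
    μ≤ = ≤-trans (subst (_≤ K) (proj₂ (maximum-attained ks)) (lookup≤product pos _)) (m≤n*m K (suc d))

0<toℚ : ∀ c → 0ℚ ℚ.< toℚ (suc c)
0<toℚ c = ℚₚ.positive⁻¹ (toℚ (suc c)) {{ℚₚ.normalize-pos (suc c) 1}}

theorem2p5 : (d k : ℕ) → .{{_ : NonZero k}} →
    (P : Matrix (cube d k)) → IsPermutation P →
    (ks : Vec ℕ d) (pos : All NonZero ks) (two : AtLeastTwo>1 ks) →
    ∃₂ λ C₁ C₂ → 0ℚ ℚ.< C₁ × 0ℚ ℚ.< C₂ ×
    ((n : ℕ) → .{{_ : NonZero n}} →
    (C₁ · n ^ (toℚ d ℚ.- β ks pos two) ≤ʳ f n (P ⊗ R ks)) ×
    (f n (P ⊗ R ks) ≤ʳ C₂ · n ^ (toℚ d ℚ.- α ks pos)))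
theorem2p5 zero    _       P perm ks pos (() , _)
theorem2p5 (suc d) zero {{k≢0}} P perm ks pos two = ⊥-elim (ℕ.≢-nonZero⁻¹ 0 {{k≢0}} refl)
theorem2p5 (suc d) (suc k) P perm ks pos two =
  -- The first constant is the reciprocal of the 8 in `deletion-bound`; the successor makes the
  -- second one positive.
  (ℤ.+ 1) ℚ./ 8 , toℚ (suc C) , ℚₚ.positive⁻¹ ((ℤ.+ 1) ℚ./ 8) , 0<toℚ C , λ n →
    β-lower ks pos two n (f n (P ⊗ R ks)) 8 ((ℤ.+ 1) ℚ./ 8) refl
      (ones-lower P perm ks pos two n (f n (P ⊗ R ks)) (f-upper n (P ⊗ R ks))) ,
    upper n (f-attained n (P ⊗ R ks) (some-avoider P perm ks pos two n))
  where
  C : ℕ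
  C = proj₁ (ones-upper P perm ks pos two)
  upper : ∀ n .{{_ : NonZero n}} →
    (∃ λ (A : Matrix (cube (suc d) n)) → Avoids A (P ⊗ R ks) × ones A ≡ f n (P ⊗ R ks)) →
    f n (P ⊗ R ks) ≤ʳ toℚ (suc C) · n ^ (toℚ (suc d) ℚ.- α ks pos)
  upper n (A , avoids , ones≡) =
    subst (λ M → M ≤ʳ toℚ (suc C) · n ^ (toℚ (suc d) ℚ.- α ks pos)) ones≡
      (α-upper ks pos two n (ones A) (suc C) (proj₂ (ones-upper P perm ks pos two) n A avoids))
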